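{- For every $d\in\mathbb{N}$ with $d\ge2$ there is a constant $\delta=\delta(d)\in(0,1]$ such that for every $d$-regular graph $\mathcal{E}$ with expansion ratio $h(\mathcal{E})\ge1$ and every linear order $f$ of $E(\vec{\mathcal{E}})$, the graph $G_{\mathcal{E}}$ is $\delta$-locally Hamiltonian on $\mathcal{C}_{d+3}$.
   Context: All graphs are finite and simple. $\mathcal{C}_D$ is the class of graphs of maximum degree at most $D$. For $S\subseteq V(G)$, $N_G(S)=S\cup\{v:v\text{ adjacent to some }w\in S\}$ (closed neighbourhood). For a class $\mathcal{C}$ and $\delta\in(0,1]$, $G\in\mathcal{C}$ is $\delta$-locally Hamiltonian on $\mathcal{C}$ if for every $S\subseteq V(G)$ with $|S|\le\delta|V(G)|$ there exist a Hamiltonian graph $H\in\mathcal{C}$ with $|V(H)|=|V(G)|$, a set $T\subseteq V(H)$ and an isomorphism from $G[N_G(S)]$ to $H[N_H(T)]$ mapping $S$ onto $T$. The expansion ratio is $h(G)=\min_{S\subset V(G),\,|S|\le|V(G)|/2}\frac{|\{e\in E(G):|e\cap S|=1\}|}{|S|}$. Construction. For a $d$-regular graph $\mathcal{E}$, let $\vec{\mathcal{E}}$ be the directed graph on $V(\mathcal{E})$ containing both $(u,v)$ and $(v,u)$ for each edge $\{u,v\}\in E(\mathcal{E})$. For vertices $v_1,\dots,v_{31}$, $P(v_1,\dots,v_{31})$ is the graph on these vertices with edges $\{v_i,v_{i+1}\}$ ($1\le i\le 30$), $\{v_2,v_5\},\{v_{27},v_{30}\},\{v_6,v_{11}\},\{v_{12},v_{17}\},\{v_{15},v_{20}\},\{v_{21},v_{26}\}$.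 A link from $P(u_1,\dots,u_{31})$ to $P(v_1,\dots,v_{31})$ via $w_1,\dots,w_6$ consists of the edges $\{u_{23},v_3\},\{u_{18},v_8\},\{u_{29},v_9\},\{u_{24},v_{14}\},\{v_5,w_1\},\{w_1,w_2\},\{w_2,w_3\},\{w_3,u_{23}\},\{u_{24},w_4\},\{w_4,w_5\},\{w_5,w_6\},\{w_6,v_{12}\}$. Let $m=|E(\vec{\mathcal{E}})|$ and $f:E(\vec{\mathcal{E}})\to\{1,\dots,m\}$ a bijection. $G_{\mathcal{E}}$ has pairwise distinct vertices $a^e_1,\dots,a^e_{31}$ for each $e\in E(\vec{\mathcal{E}})$ and $b^v_1,\dots,b^v_6$ for each $v\in V(\mathcal{E})$, and its edge set is exactly the union of: the edges of $P(a^e_1,\dots,a^e_{31})$ for each $e$; the edges $\{a^{f^{ -1}(i)}_{31},a^{f^{ -1}(j)}_1\}$ for $i\in\{1,\dots,m\}$, where $j=i+1$ if $i<m$ and $j=1$ if $i=m$; and, for all vertices $u,v,w$ with $(u,v),(v,w)\in E(\vec{\mathcal{E}})$, the edges of a link from $P(a^{(u,v)}_1,\dots,a^{(u,v)}_{31})$ to $P(a^{(v,w)}_1,\dots,a^{(v,w)}_{31})$ via $b^v_1,\dots,b^v_6$. The graph $G_{\mathcal{E}}$ has maximum degree at most $d+3$. -}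

module Defs where

open import Data.Bool using (Bool; true; false; _∧_; _∨_; not; if_then_else_)
open import Data.Bool.Properties using (∨-comm)
open import Data.Nat using (ℕ; zero; suc; _+_; _*_; _≤_; _<_; _≡ᵇ_)
open import Data.Fin using (Fin; toℕ; splitAt; remQuot)
open import Data.Fin.Properties using (_≟_)
open import Data.Fin.Subset using (Subset; ∣_∣)
open import Data.Vec using (Vec; lookup; tabulate; sum)
open import Data.List using (allFin)
open import Data.Bool.ListAction using (any)
open import Data.Product using (Σ; ∃; _×_; _,_; proj₁; proj₂)
open import Data.Sum using (_⊎_; inj₁; inj₂)
open import Relation.Nullary using (does)
open import Relation.Binary.PropositionalEquality using (_≡_)

record Graph (n : ℕ) : Set where
  field
    adj : Fin n → Fin n → Bool
    sym : ∀ x y → adj x y ≡ adj y x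
open Graph public

IsSimple : ∀ {n} → Graph n → Set
IsSimple G = ∀ v → adj G v v ≡ false

deg : ∀ {n} → Graph n → Fin n → ℕ
deg G v = ∣ tabulate (adj G v) ∣

Regular : ∀ {n} → ℕ → Graph n → Set
Regular d G = ∀ v → deg G v ≡ d

InC : ∀ {n} → ℕ → Graph n → Set
InC D G = IsSimple G × (∀ v → deg G v ≤ D)

-- number of edges with exactly one end in S
-- (each such edge {u,w}, u ∈ S, w ∉ S, is counted once, by the pair (u,w))
boundary : ∀ {n} → Graph n → Subset n → ℕ
boundary {n} G S =
  sum (tabulate λ u → if lookup S u
                      then ∣ tabulate (λ w → adj G u w ∧ not (lookup S w)) ∣
                      else 0)

ExpansionAtLeast1 : ∀ {n} → Graph n → Set
ExpansionAtLeast1 {n} G = ∀ (S : Subset n) → 2 * ∣ S ∣ ≤ n → ∣ S ∣ ≤ boundary G S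

closedNbhd : ∀ {n} → Graph n → Subset n → Subset n
closedNbhd {n} G S =
  tabulate λ x → lookup S x ∨ any (λ w → lookup S w ∧ adj G w x) (allFin n)

Hamiltonian : ∀ {n} → Graph n → Set
Hamiltonian {n} H =
  3 ≤ n ×
  Σ (Fin n → Fin n) λ σ →
    (∀ i j → σ i ≡ σ j → i ≡ j) ×
    (∀ i j → (suc (toℕ i) ≡ toℕ j ⊎ (suc (toℕ i) ≡ n × toℕ j ≡ 0)) →
       adj H (σ i) (σ j) ≡ true)

LocalIso : ∀ {n} → Graph n → Subset n → Graph n → Subset n → (Fin n → Fin n) → Set
LocalIso {n} G S H T φ =
  let NG = closedNbhd G S
      NH = closedNbhd H T
  in (∀ x → lookup NG x ≡ true → lookup NH (φ x) ≡ true) ×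
     (∀ x y → lookup NG x ≡ true → lookup NG y ≡ true → φ x ≡ φ y → x ≡ y) ×
     (∀ y → lookup NH y ≡ true → ∃ λ x → lookup NG x ≡ true × φ x ≡ y) ×
     (∀ x y → lookup NG x ≡ true → lookup NG y ≡ true →
        adj G x y ≡ adj H (φ x) (φ y)) ×
     (∀ x → lookup NG x ≡ true → lookup S x ≡ lookup T (φ x))

-- G is δ-locally Hamiltonian on 𝒞_D, with δ = p / q
LocallyHamiltonian : ∀ {n} → ℕ → (p q : ℕ) → Graph n → Set
LocallyHamiltonian {n} D p q G =
  InC D G ×
  (∀ (S : Subset n) → q * ∣ S ∣ ≤ p * n →
     Σ (Graph n) λ H → InC D H × Hamiltonian H ×
       Σ (Subset n) λ T → Σ (Fin n → Fin n) λ φ → LocalIso G S H T φ)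

-- Linear orders of the arc set E(E⃗): given as f⁻¹ : Fin m → arcs,
-- i.e. arc i = f⁻¹(i+1), a bijection onto the set of ordered pairs (u,v)
-- with u ~ v.

IsArcOrder : ∀ {n} → Graph n → (m : ℕ) → (Fin m → Fin n × Fin n) → Set
IsArcOrder {n} E m arc =
  (∀ i j → arc i ≡ arc j → i ≡ j) ×
  (∀ i → adj E (proj₁ (arc i)) (proj₂ (arc i)) ≡ true) ×
  (∀ u v → adj E u v ≡ true → ∃ λ i → arc i ≡ (u , v))

-- The construction G_E.
-- Vertices: a i k  = a^{f⁻¹(i+1)}_{k+1}  (i : Fin m, k : Fin 31)
--           b v l  = b^v_{l+1}           (v : Fin n, l : Fin 6)

data GV (m n : ℕ) : Set where
  a : Fin m → Fin 31 → GV m n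
  b : Fin n → Fin 6 → GV m n

-- "k is the (1-based) label L"
_is_ : ∀ {r} → Fin r → ℕ → Bool
k is L = suc (toℕ k) ≡ᵇ L

_==_ : ∀ {r} → Fin r → Fin r → Bool
i == j = does (i ≟ j)

-- edges of P(v_1,…,v_31) (one orientation of each)
pEdge : Fin 31 → Fin 31 → Bool
pEdge k k' =
  (suc (toℕ k) ≡ᵇ toℕ k') ∨
  (k is 2 ∧ k' is 5) ∨ (k is 27 ∧ k' is 30) ∨ (k is 6 ∧ k' is 11) ∨
  (k is 12 ∧ k' is 17) ∨ (k is 15 ∧ k' is 20) ∨ (k is 21 ∧ k' is 26)

module Construction {n : ℕ} (E : Graph n) (m : ℕ) (arc : Fin m → Fin n × Fin n) where

  src tgt : Fin m → Fin n
  src i = proj₁ (arc i)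
  tgt i = proj₂ (arc i)

  -- v has an in-arc (u,v) and an out-arc (v,w), i.e. some link uses b^v
  hasIn hasOut : Fin n → Bool
  hasIn v = any (λ i → tgt i == v) (allFin m)
  hasOut v = any (λ j → src j == v) (allFin m)

  nextArc : Fin m → Fin m → Bool
  nextArc i i' = (suc (toℕ i) ≡ᵇ toℕ i') ∨ ((suc (toℕ i) ≡ᵇ m) ∧ (toℕ i' ≡ᵇ 0))

  -- one orientation of every edge of G_E
  gen : GV m n → GV m n → Bool
  gen (a i k) (a j k') =
    (i == j ∧ pEdge k k') ∨
    (k is 31 ∧ k' is 1 ∧ nextArc i j) ∨
    (tgt i == src j ∧
      ((k is 23 ∧ k' is 3) ∨ (k is 18 ∧ k' is 8) ∨
       (k is 29 ∧ k' is 9) ∨ (k is 24 ∧ k' is 14)))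
  gen (a j k) (b v l) =
    -- j = (v,w) is the second arc of a link at v
    (src j == v ∧ hasIn v ∧ ((k is 5 ∧ l is 1) ∨ (k is 12 ∧ l is 6))) ∨
    -- j = (u,v) is the first arc of a link at v
    (tgt j == v ∧ hasOut v ∧ ((k is 23 ∧ l is 3) ∨ (k is 24 ∧ l is 4)))
  gen (b v l) (a j k) = false
  gen (b v l) (b v' l') =
    v == v' ∧ hasIn v ∧ hasOut v ∧
    ((l is 1 ∧ l' is 2) ∨ (l is 2 ∧ l' is 3) ∨ (l is 4 ∧ l' is 5) ∨ (l is 5 ∧ l' is 6))

  adjGV : GV m n → GV m n → Bool
  adjGV x y = gen x y ∨ gen y x

  decode : Fin (m * 31 + n * 6) → GV m n
  decode x with splitAt (m * 31) x
  ... | inj₁ p = a (proj₁ (remQuot {m} 31 p)) (proj₂ (remQuot {m} 31 p))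
  ... | inj₂ q = b (proj₁ (remQuot {n} 6 q)) (proj₂ (remQuot {n} 6 q))

  GE : Graph (m * 31 + n * 6)
  GE = record
    { adj = λ x y → adjGV (decode x) (decode y)
    ; sym = λ x y → ∨-comm (gen (decode x) (decode y)) (gen (decode y) (decode x))
    }

G[_,_,_] : ∀ {n} → Graph n → (m : ℕ) → (Fin m → Fin n × Fin n) → Graph (m * 31 + n * 6)
G[ E , m , arc ] = Construction.GE E m arc

-- Let H keep the edges of G = G_E inside N(S) and add a cyclic ordering of all vertices in
-- which every step meeting N(S) is an edge of G. Such an H is Hamiltonian, agrees with G
-- around S, and has no larger degrees.
--
-- Call v ∈ V(E) dirty when N(S) meets b^v or some a^e with e incident to v; for small δ at
-- most half of the vertices are dirty. By expansion and augmenting paths there is a set of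
-- used arcs such that at each dirty vertex exactly one more used arc enters than leaves.
-- So at a dirty v the used arcs entering v can be matched with the used arcs leaving v
-- together with one unused arc leaving v, the exit of v.
--
-- Start with the paths P(a^e) in the order f. For each matched pair (e, e′) exchange the
-- piece 21–26 of P(a^e) with the piece 6–11 of P(a^e′) along link edges; if e′ is the exit
-- of v, pass through b^v on the way. All paths keep their ends, and every b^v is visited.
-- A vertex labelled by a clean v, or by an arc with a clean end, lies outside N(S), so steps
-- between two such vertices are unrestricted, and this is where chains of exchanges start.

{-# OPTIONS --safe #-}
module Submission where

open import Defs
open import Data.Nat using (ℕ; _+_; _≤_; _<_)
open import Data.Fin using (Fin)
open import Data.Product using (Σ; _×_)

open import Data.Bool using (Bool; true; false; _∧_; _∨_; not; if_then_else_)
import Data.Bool as Bool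
open import Data.Bool.ListAction using (any)
open import Data.Bool.Properties using (∧-zeroʳ; ∧-identityʳ; ∧-comm; ∨-comm; ∨-identityʳ; ¬-not; T-≡; T?)
open import Data.Empty using (⊥; ⊥-elim)
open import Data.Fin.Patterns
open import Data.Fin using (zero; suc; toℕ; fromℕ; inject₁; splitAt; combine; fromℕ<; _↑ˡ_; _↑ʳ_; punchOut)
open import Data.Fin.Properties using (_≟_; any?; all?; toℕ-injective; toℕ-fromℕ; toℕ-inject₁; toℕ<n)
import Data.Fin.Properties as Fin
open import Data.Fin.Subset using (Subset; ∣_∣)
open import Data.List using (List; []; _∷_; _++_; [_]; length; map; filterᵇ; allFin; concat; concatMap)
import Data.List as List
import Data.List.Properties as List
import Data.List.Membership.DecPropositional as DecMembership
open import Data.List.Membership.Propositional using (_∈_; lose; find)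
open import Data.List.Membership.Propositional.Properties
  using (∈-++⁺ˡ; ∈-++⁺ʳ; ∈-map⁺; ∈-map⁻; ∈-filter⁺; ∈-filter⁻; ∈-allFin; ∈-concatMap⁺; ∈-concat⁺′; ∈-tabulate⁺)
open import Data.List.Relation.Unary.All using ([]; _∷_)
import Data.List.Relation.Unary.All as All
import Data.List.Relation.Unary.All.Properties as All
open import Data.List.Relation.Unary.Any using (here; there)
import Data.List.Relation.Unary.Any as Any
import Data.List.Relation.Unary.Any.Properties as Any
open import Data.List.Relation.Unary.AllPairs using ([]; _∷_)
open import Data.List.Relation.Unary.Unique.Propositional using (Unique)
import Data.List.Relation.Unary.Unique.Propositional.Properties as Unique
open import Data.Nat using (zero; suc; _*_; _∸_; _≡ᵇ_; z≤n; s≤s)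
import Data.Nat as ℕ
open import Data.Nat.Properties hiding (_≟_)
open import Data.Nat.DivMod using (_mod_)
open import Data.Nat.Tactic.RingSolver using (solve-∀)
open import Data.Product using (∃; _,_; proj₁; proj₂)
open import Data.Sum using (_⊎_; inj₁; inj₂)
import Data.Sum as Sum
open import Data.Unit using (tt)
open import Data.Vec using (lookup; tabulate)
import Data.Vec as Vec
open import Data.Vec.Properties using (lookup∘tabulate; tabulate∘lookup)
open import Function using (_∘_; id; case_of_; const)
open import Function.Bundles using (Equivalence)
open import Relation.Nullary using (¬_; Dec; yes; no; does; contradiction)
open import Relation.Nullary.Decidable using (dec-true; dec-false; toWitness; _×-dec_; _⊎-dec_)
open import Relation.Binary.PropositionalEquality
  using (_≡_; _≢_; refl; trans; cong; cong₂; subst; subst₂; module ≡-Reasoning)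
import Relation.Binary.PropositionalEquality as ≡

open import Algebra.Properties.CommutativeMonoid.Sum +-0-commutativeMonoid
  using (∑-distrib-+; ∑-comm; sum-cong-≗) renaming (sum to ∑)

-- Finite sums, counting and Boolean predicates.

⟦_⟧ : Bool → ℕ
⟦ true  ⟧ = 1
⟦ false ⟧ = 0

count : ∀ {n} → (Fin n → Bool) → ℕ
count f = ∑ (⟦_⟧ ∘ f)

==-refl : ∀ {n} (i : Fin n) → (i == i) ≡ true
==-refl i = dec-true (i ≟ i) refl

==⇒≡ : ∀ {n} (i j : Fin n) → (i == j) ≡ true → i ≡ j
==⇒≡ i j _ with yes p ← i ≟ j = p

≢⇒==-false : ∀ {n} {i j : Fin n} → i ≢ j → (i == j) ≡ false
≢⇒==-false {i = i} {j} = dec-false (i ≟ j)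

==-comm : ∀ {n} (i j : Fin n) → (i == j) ≡ (j == i)
==-comm i j with i ≟ j
... | yes refl = ≡.sym (==-refl i)
... | no i≢j = ≡.sym (≢⇒==-false (i≢j ∘ ≡.sym))

∑-mono : ∀ {n} {f g : Fin n → ℕ} → (∀ i → f i ≤ g i) → ∑ f ≤ ∑ g
∑-mono {zero}  f≤g = z≤n
∑-mono {suc n} f≤g = +-mono-≤ (f≤g zero) (∑-mono (f≤g ∘ suc))

∑-zero : ∀ {n} {f : Fin n → ℕ} → (∀ i → f i ≡ 0) → ∑ f ≡ 0
∑-zero {zero}  f≡0 = refl
∑-zero {suc n} f≡0 = cong₂ _+_ (f≡0 zero) (∑-zero (f≡0 ∘ suc))

∑-const : ∀ n k → ∑ {n} (const k) ≡ n * k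
∑-const zero    k = refl
∑-const (suc n) k = cong (k +_) (∑-const n k)

∑-*ˡ : ∀ {n} k (f : Fin n → ℕ) → ∑ (λ i → k * f i) ≡ k * ∑ f
∑-*ˡ {zero}  k f = ≡.sym (*-zeroʳ k)
∑-*ˡ {suc n} k f = trans (cong (k * f zero +_) (∑-*ˡ k (f ∘ suc))) (≡.sym (*-distribˡ-+ k (f zero) _))

∑-mono-< : ∀ {n} {f g : Fin n → ℕ} → (∀ i → f i ≤ g i) → ∀ i → f i < g i → ∑ f < ∑ g
∑-mono-< f≤g zero    lt = +-mono-<-≤ lt (∑-mono (f≤g ∘ suc))
∑-mono-< f≤g (suc i) lt = +-mono-≤-< (f≤g zero) (∑-mono-< (f≤g ∘ suc) i lt)

∑-<⇒∃< : ∀ {n} (f g : Fin n → ℕ) → ∑ f < ∑ g → ∃ λ i → f i < g i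
∑-<⇒∃< f g lt with any? (λ i → f i <? g i)
... | yes found = found
... | no none = contradiction lt (≤⇒≯ (∑-mono λ i → ≮⇒≥ (none ∘ (i ,_))))

count-≡ : ∀ {n} (j : Fin n) → count (_== j) ≡ 1
count-≡ {suc n} zero = cong suc (∑-zero {n} {λ _ → 0} λ _ → refl)
count-≡ {suc n} (suc j) = trans (sum-cong-≗ λ i → cong ⟦_⟧ (suc-== i)) (count-≡ j)
  where
  suc-== : ∀ i → (suc i == suc j) ≡ (i == j)
  suc-== i with i ≟ j
  ... | yes _ = refl
  ... | no  _ = refl

∣tabulate∣ : ∀ {n} (f : Fin n → Bool) → ∣ tabulate f ∣ ≡ count f
∣tabulate∣ {zero}  f = refl
∣tabulate∣ {suc n} f with f zero
... | true  = cong suc (∣tabulate∣ (f ∘ suc))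
... | false = ∣tabulate∣ (f ∘ suc)

∣∣≡count : ∀ {n} (S : Subset n) → ∣ S ∣ ≡ count (lookup S)
∣∣≡count S = trans (cong ∣_∣ (≡.sym (tabulate∘lookup S))) (∣tabulate∣ (lookup S))

sum-tabulate : ∀ {n} (f : Fin n → ℕ) → Vec.sum (tabulate f) ≡ ∑ f
sum-tabulate {zero}  f = refl
sum-tabulate {suc n} f = cong (f zero +_) (sum-tabulate (f ∘ suc))

⟦⟧-mono : ∀ {x y} → (x ≡ true → y ≡ true) → ⟦ x ⟧ ≤ ⟦ y ⟧
⟦⟧-mono {true}  x⇒y rewrite x⇒y refl = ≤-refl
⟦⟧-mono {false} x⇒y = z≤n

count-mono : ∀ {n} {f g : Fin n → Bool} → (∀ i → f i ≡ true → g i ≡ true) → count f ≤ count g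
count-mono f⇒g = ∑-mono (⟦⟧-mono ∘ f⇒g)

∧-true : ∀ {x y} → x ∧ y ≡ true → x ≡ true × y ≡ true
∧-true {true} y≡true = refl , y≡true

∨-true : ∀ {x y} → x ∨ y ≡ true → x ≡ true ⊎ y ≡ true
∨-true {true}  _ = inj₁ refl
∨-true {false} y≡true = inj₂ y≡true

∨-trueˡ : ∀ {x y} → x ≡ true → x ∨ y ≡ true
∨-trueˡ refl = refl

∨-trueʳ : ∀ {x y} → y ≡ true → x ∨ y ≡ true
∨-trueʳ {true}  _ = refl
∨-trueʳ {false} y≡true = y≡true

∧-true⁺ : ∀ {x y} → x ≡ true → y ≡ true → x ∧ y ≡ true
∧-true⁺ refl refl = refl

∨-falseˡ : ∀ {x y} → x ∨ y ≡ false → x ≡ false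
∨-falseˡ {false} _ = refl

not-true⁻ : ∀ {x} → not x ≡ true → x ≡ false
not-true⁻ {false} _ = refl

true? : ∀ x → x ≡ true ⊎ x ≡ false
true? true  = inj₁ refl
true? false = inj₂ refl

true≢false : ∀ {x} → x ≡ true → x ≡ false → ⊥
true≢false refl ()

-- Each entry of `L` accounts for at most one element, so repetitions in `L` do no harm. Degrees and
-- the number of dirty vertices are bounded in this way.
count-≤-length : ∀ {n} (f : Fin n → Bool) (L : List (Fin n)) →
  (∀ y → f y ≡ true → y ∈ L) → count f ≤ length L
count-≤-length f [] f⊆ = ≤-reflexive (∑-zero none)
  where
  none : ∀ i → ⟦ f i ⟧ ≡ 0
  none i with f i in fi
  ... | true  = case f⊆ i fi of λ ()
  ... | false = refl
count-≤-length f (z ∷ L) f⊆ = begin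
  count f                               ≤⟨ ∑-mono split ⟩
  ∑ (λ y → ⟦ y == z ⟧ + ⟦ f′ y ⟧)       ≡⟨ ∑-distrib-+ (λ y → ⟦ y == z ⟧) (⟦_⟧ ∘ f′) ⟩
  count (_== z) + count f′              ≡⟨ cong (_+ count f′) (count-≡ z) ⟩
  suc (count f′)                        ≤⟨ s≤s (count-≤-length f′ L f′⊆) ⟩
  suc (length L)                        ∎
  where
  open ≤-Reasoning
  f′ : Fin _ → Bool
  f′ y = not (y == z) ∧ f y
  split : ∀ y → ⟦ f y ⟧ ≤ ⟦ y == z ⟧ + ⟦ f′ y ⟧
  split y with y == z
  ... | false = ≤-refl
  ... | true with f y
  ...   | true  = ≤-refl
  ...   | false = z≤n
  f′⊆ : ∀ y → f′ y ≡ true → y ∈ L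
  f′⊆ y p with y ≟ z
  ... | no y≢z with f⊆ y p
  ...   | here y≡z = contradiction y≡z y≢z
  ...   | there y∈L = y∈L

any-true⁺ : ∀ {A : Set} (p : A → Bool) {x xs} → x ∈ xs → p x ≡ true → any p xs ≡ true
any-true⁺ p x∈xs px = Equivalence.to T-≡ (Any.any⁺ p (lose x∈xs (Equivalence.from T-≡ px)))

any-true⁻ : ∀ {A : Set} (p : A → Bool) xs → any p xs ≡ true → ∃ λ x → x ∈ xs × p x ≡ true
any-true⁻ p xs h with x , x∈xs , px ← find (Any.any⁻ p xs (Equivalence.from T-≡ h)) =
  x , x∈xs , Equivalence.to T-≡ px

∈-filterᵇ⁺ : ∀ {A : Set} (p : A → Bool) {x xs} → x ∈ xs → p x ≡ true → x ∈ filterᵇ p xs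
∈-filterᵇ⁺ p x∈xs px = ∈-filter⁺ (T? ∘ p) x∈xs (Equivalence.from T-≡ px)

∈-filterᵇ⁻ : ∀ {A : Set} (p : A → Bool) {x xs} → x ∈ filterᵇ p xs → p x ≡ true
∈-filterᵇ⁻ p {xs = xs} h = Equivalence.to T-≡ (proj₂ (∈-filter⁻ (T? ∘ p) {xs = xs} h))

length-filterᵇ-tabulate : ∀ {n} {A : Set} (p : A → Bool) (g : Fin n → A) →
  length (filterᵇ p (List.tabulate g)) ≡ count (p ∘ g)
length-filterᵇ-tabulate {zero}  p g = refl
length-filterᵇ-tabulate {suc n} p g with p (g zero)
... | true  = cong suc (length-filterᵇ-tabulate p (g ∘ suc))
... | false = length-filterᵇ-tabulate p (g ∘ suc)

length-filterᵇ-allFin : ∀ {n} (p : Fin n → Bool) → length (filterᵇ p (allFin n)) ≡ count p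
length-filterᵇ-allFin p = length-filterᵇ-tabulate p id

-- Arc sets with prescribed excess and their residual graphs.

module Flow {n : ℕ} (E : Graph n) (D : Fin n → Bool) where

  ArcSet : Set
  ArcSet = Fin n → Fin n → Bool

  inflow outflow : ArcSet → Fin n → ℕ
  inflow  F v = count (λ u → F u v)
  outflow F v = count (F v)

  InE : ArcSet → Set
  InE F = ∀ u v → F u v ≡ true → adj E u v ≡ true

  -- Passing from F to G moves one unit of excess (inflow − outflow) from x to y;
  -- stated without subtraction.
  Shift : (F G : ArcSet) (x y : Fin n) → Set
  Shift F G x y = ∀ v →
    inflow G v + outflow F v + ⟦ v == x ⟧ ≡ inflow F v + outflow G v + ⟦ v == y ⟧

  -- The two equations are added; the flows of the intermediate arc set `G` and the indicator of `y`
  -- then occur on both sides and cancel.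
  shift-trans : ∀ {F G H x y z} → Shift F G y z → Shift G H x y → Shift F H x z
  shift-trans {F} {G} {H} {x} {y} {z} s t v =
    +-cancelʳ-≡ (inflow G v + outflow G v + ⟦ v == y ⟧) _ _
      (trans (lhs (inflow H v) (outflow F v) ⟦ v == x ⟧ (inflow G v) (outflow G v) ⟦ v == y ⟧)
        (trans (cong₂ _+_ (s v) (t v))
          (rhs (inflow F v) (outflow G v) ⟦ v == z ⟧ (inflow G v) (outflow H v) ⟦ v == y ⟧)))
    where
    lhs : ∀ i₂ o₀ x i₁ o₁ y → i₂ + o₀ + x + (i₁ + o₁ + y) ≡ (i₁ + o₀ + y) + (i₂ + o₁ + x)
    lhs = solve-∀
    rhs : ∀ i₀ o₁ z i₁ o₂ y → (i₀ + o₁ + z) + (i₁ + o₂ + y) ≡ i₀ + o₂ + z + (i₁ + o₁ + y)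
    rhs = solve-∀

  -- `G` is `F` with the arc `(x, y)` added. As an equation between numbers it also forces `(x, y)`
  -- to be absent from `F`, and it can be summed directly to compare flows.
  Extends : (F G : ArcSet) (x y : Fin n) → Set
  Extends F G x y = ∀ u v → ⟦ G u v ⟧ ≡ ⟦ F u v ⟧ + ⟦ (u == x) ∧ (v == y) ⟧

  count-==-∧ : ∀ x c → count (λ u → (u == x) ∧ c) ≡ ⟦ c ⟧
  count-==-∧ x true  = trans (sum-cong-≗ {n} λ u → cong ⟦_⟧ (∧-identityʳ (u == x))) (count-≡ x)
  count-==-∧ x false = ∑-zero {n} λ u → cong ⟦_⟧ (∧-zeroʳ (u == x))

  extends-inflow : ∀ {F G x y} → Extends F G x y → ∀ v → inflow G v ≡ inflow F v + ⟦ v == y ⟧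
  extends-inflow {F} {G} {x} {y} ext v = trans (sum-cong-≗ {n} λ u → ext u v)
    (trans (∑-distrib-+ {n} (λ u → ⟦ F u v ⟧) (λ u → ⟦ (u == x) ∧ (v == y) ⟧))
      (cong (inflow F v +_) (count-==-∧ x (v == y))))

  extends-outflow : ∀ {F G x y} → Extends F G x y → ∀ v → outflow G v ≡ outflow F v + ⟦ v == x ⟧
  extends-outflow {F} {G} {x} {y} ext v = trans (sum-cong-≗ {n} λ w → ext v w)
    (trans (∑-distrib-+ {n} (λ w → ⟦ F v w ⟧) (λ w → ⟦ (v == x) ∧ (w == y) ⟧))
      (cong (outflow F v +_) (trans
        (sum-cong-≗ {n} λ w → cong ⟦_⟧ (∧-comm (v == x) (w == y)))
        (count-==-∧ y (v == x)))))

  extends⇒shift : ∀ {F G x y} → Extends F G x y → Shift F G x y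
  extends⇒shift {F} {G} {x} {y} ext v
    rewrite extends-inflow {F} {G} ext v | extends-outflow {F} {G} ext v =
    eq (inflow F v) ⟦ v == y ⟧ (outflow F v) ⟦ v == x ⟧
    where
    eq : ∀ i y o x → i + y + o + x ≡ i + (o + x) + y
    eq = solve-∀

  extends⇒shift⁻ : ∀ {F G x y} → Extends F G x y → Shift G F y x
  extends⇒shift⁻ {F} {G} {x} {y} ext v
    rewrite extends-inflow {F} {G} ext v | extends-outflow {F} {G} ext v =
    eq (inflow F v) ⟦ v == y ⟧ (outflow F v) ⟦ v == x ⟧
    where
    eq : ∀ i y o x → i + (o + x) + y ≡ i + y + o + x
    eq = solve-∀

  residual : ArcSet → Fin n → Fin n → Bool
  residual F x y = adj E x y ∧ (not (F x y) ∨ F y x)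

  -- All changes are confined to arcs with both ends in `X`. Hence residual steps that enter `X`
  -- from outside survive the changes.
  Agree : (X : Fin n → Bool) (F G : ArcSet) → Set
  Agree X F G = ∀ u v → X u ≡ false ⊎ X v ≡ false → G u v ≡ F u v

  push : ∀ F x y → InE F → residual F x y ≡ true →
    ∃ λ G → InE G × Shift F G x y ×
      (∀ X → X x ≡ true → X y ≡ true → Agree X F G)
  push F x y F⊆E res with ∧-true {adj E x y} res
  ... | xy∈E , _ with F x y in Fxy
  ...   | false = G , G⊆E , extends⇒shift ext , agree
    where
    G : ArcSet
    G u v = F u v ∨ ((u == x) ∧ (v == y))
    G⊆E : InE G
    G⊆E u v Guv with ∨-true {F u v} Guv
    ... | inj₁ Fuv = F⊆E u v Fuv
    ... | inj₂ eqs with ∧-true {u == x} eqs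
    ...   | u=x , v=y rewrite ==⇒≡ u x u=x | ==⇒≡ v y v=y = xy∈E
    ext : Extends F G x y
    ext u v with u ≟ x | v ≟ y
    ... | yes refl | yes refl rewrite Fxy = refl
    ... | yes refl | no _ rewrite ∨-identityʳ (F x v) = ≡.sym (+-identityʳ _)
    ... | no _ | _ rewrite ∨-identityʳ (F u v) = ≡.sym (+-identityʳ _)
    agree : ∀ X → X x ≡ true → X y ≡ true → Agree X F G
    agree X Xx Xy u v out with u ≟ x | v ≟ y
    ... | no _ | _ = ∨-identityʳ _
    ... | yes _ | no _ = ∨-identityʳ _
    ... | yes refl | yes refl with out
    ...   | inj₁ ¬Xx = ⊥-elim (true≢false Xx ¬Xx)
    ...   | inj₂ ¬Xy = ⊥-elim (true≢false Xy ¬Xy)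
  -- The arc `(x, y)` is already used, so the residual step must come from the used arc `(y, x)`,
  -- which is deleted.
  push F x y F⊆E res | _ , Fyx | true = G , G⊆E , extends⇒shift⁻ ext , agree
    where
    G : ArcSet
    G u v = F u v ∧ not ((u == y) ∧ (v == x))
    G⊆E : InE G
    G⊆E u v Guv = F⊆E u v (proj₁ (∧-true Guv))
    ext : Extends G F y x
    ext u v with u ≟ y | v ≟ x
    ... | yes refl | yes refl rewrite Fyx = refl
    ... | yes refl | no _ rewrite ∧-identityʳ (F y v) = ≡.sym (+-identityʳ _)
    ... | no _ | _ rewrite ∧-identityʳ (F u v) = ≡.sym (+-identityʳ _)
    agree : ∀ X → X x ≡ true → X y ≡ true → Agree X F G
    agree X Xx Xy u v out with u ≟ y | v ≟ x
    ... | no _ | _ = ∧-identityʳ _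
    ... | yes _ | no _ = ∧-identityʳ _
    ... | yes refl | yes refl with out
    ...   | inj₁ ¬Xy = ⊥-elim (true≢false Xy ¬Xy)
    ...   | inj₂ ¬Xx = ⊥-elim (true≢false Xx ¬Xx)

  -- The vertex sets met while searching backwards from r in the residual graph of F.
  data Grown (F : ArcSet) (r : Fin n) : (Fin n → Bool) → Set where
    root : Grown F r (_== r)
    grow : ∀ {X} x y → Grown F r X → X x ≡ false → X y ≡ true → residual F x y ≡ true →
      Grown F r (λ v → X v ∨ (v == x))

  grown-root : ∀ {F r X} → Grown F r X → X r ≡ true
  grown-root {r = r} root = ==-refl r
  grown-root (grow x y g _ _ _) = ∨-trueˡ (grown-root g)

  -- A new vertex x of X has no changed arcs yet, so the step x → y is still residual
  -- after rerouting from y inside the smaller set.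
  reroute : ∀ {F r X} → InE F → Grown F r X → ∀ z → X z ≡ true →
    ∃ λ G → InE G × Shift F G z r × Agree X F G
  reroute {F} {r} F⊆E root z z=r rewrite ==⇒≡ z r z=r = F , F⊆E , (λ v → refl) , λ _ _ _ → refl
  reroute {F} {r} F⊆E (grow {X} x y g ¬Xx Xy res) z X′z with ∨-true {X z} X′z
  ... | inj₁ Xz with G , G⊆E , s , agree ← reroute F⊆E g z Xz = G , G⊆E , s , agree′
    where
    agree′ : Agree (λ v → X v ∨ (v == x)) F G
    agree′ u v = agree u v ∘ Sum.map ∨-falseˡ ∨-falseˡ
  ... | inj₂ z=x rewrite ==⇒≡ z x z=x with G , G⊆E , s , agree ← reroute F⊆E g y Xy
    with H , H⊆E , t , agree′ ← push G x y G⊆E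
           (trans (cong₂ (λ p q → adj E x y ∧ (not p ∨ q))
             (agree x y (inj₁ ¬Xx)) (agree y x (inj₂ ¬Xx))) res)
    = H , H⊆E , shift-trans {F} {G} {H} s t , λ u v out →
      trans (agree′ (λ w → X w ∨ (w == x)) (∨-trueʳ {X x} (==-refl x)) (∨-trueˡ Xy) u v out)
            (agree u v (Sum.map ∨-falseˡ ∨-falseˡ out))

  -- Expansion yields augmenting paths from clean vertices.

  module _ (expansion : ExpansionAtLeast1 E) (small : 2 * count D ≤ n) where

    Unblocked : ArcSet → (Fin n → Bool) → Fin n → Fin n → Bool
    Unblocked F X x y = not (X x) ∧ (X y ∧ residual F x y)

    boundary-tabulate : ∀ X → boundary E (tabulate X) ≡
      ∑ (λ x → ∑ (λ u → ⟦ X x ∧ (adj E x u ∧ not (X u)) ⟧))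
    boundary-tabulate X = trans (sum-tabulate summand) (sum-cong-≗ {n} pointwise)
      where
      summand : Fin n → ℕ
      summand u = if Vec.lookup (tabulate X) u
        then ∣ tabulate (λ w → adj E u w ∧ not (lookup (tabulate X) w)) ∣ else 0
      pointwise : ∀ x → summand x ≡ ∑ (λ u → ⟦ X x ∧ (adj E x u ∧ not (X u)) ⟧)
      pointwise x rewrite lookup∘tabulate X x with X x
      ... | false = ≡.sym (∑-zero {n} λ _ → refl)
      ... | true = trans (∣tabulate∣ (λ w → adj E x w ∧ not (lookup (tabulate X) w)))
        (sum-cong-≗ {n} λ u → cong (λ c → ⟦ adj E x u ∧ not c ⟧) (lookup∘tabulate X u))

    -- The invariant of the augmentation: the excess at a dirty vertex is 0 or 1. Clean vertices are
    -- unconstrained and supply the missing units.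
    Balanced : ArcSet → Set
    Balanced F = ∀ v → D v ≡ true →
      inflow F v ≡ outflow F v ⊎ inflow F v ≡ suc (outflow F v)

    -- All arcs entering a closed set are used and no arc leaving it is, so its total
    -- excess is the size of its boundary, which by expansion is at least its size.
    closed-impossible : ∀ F X r → InE F → Balanced F → (∀ v → X v ≡ true → D v ≡ true) →
      X r ≡ true → inflow F r ≡ outflow F r →
      (∀ x y → Unblocked F X x y ≡ false) → ⊥
    closed-impossible F X r F⊆E bal X⊆D Xr in≡out closed =
      <⇒≱ boundary<count (subst₂ _≤_ sizeX (boundary-tabulate X)
        (expansion (tabulate X) (subst (λ k → 2 * k ≤ n) (≡.sym sizeX)
          (≤-trans (*-monoʳ-≤ 2 (count-mono X⊆D)) small))))
      where
      open ≤-Reasoning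
      sizeX : ∣ tabulate X ∣ ≡ count X
      sizeX = ∣tabulate∣ X
      inner cut : ℕ
      inner = ∑ (λ x → ∑ (λ u → ⟦ X x ∧ (X u ∧ F u x) ⟧))
      cut   = ∑ (λ x → ∑ (λ u → ⟦ X x ∧ (adj E x u ∧ not (X u)) ⟧))

      blocked : ∀ x u → X x ≡ true → X u ≡ false → residual F u x ≡ false
      blocked x u Xx ¬Xu with closed u x
      ... | h rewrite Xx | ¬Xu = h

      -- If an edge joins `x` in `X` to `u` outside, the arc `(u, x)` is used, since otherwise
      -- adding it would be a residual step into `X`.
      entering : ∀ x u → ⟦ X x ∧ (X u ∧ F u x) ⟧ + ⟦ X x ∧ (adj E x u ∧ not (X u)) ⟧ ≤ ⟦ X x ⟧ * ⟦ F u x ⟧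
      entering x u with X x in Xx | X u in Xu
      ... | false | _ = z≤n
      ... | true | true with F u x | adj E x u
      ...   | true  | true  = ≤-refl
      ...   | true  | false = ≤-refl
      ...   | false | true  = ≤-refl
      ...   | false | false = ≤-refl
      entering x u | true | false with blocked x u Xx Xu
      ... | res rewrite sym E u x with adj E x u | F u x
      ...   | true  | true  = ≤-refl
      ...   | false | true  = z≤n
      ...   | false | false = ≤-refl

      -- A used arc from `x` in `X` to `u` outside could be deleted, which would be a residual step
      -- from `u` into `X`.
      leaving : ∀ x u → ⟦ X x ⟧ * ⟦ F x u ⟧ ≤ ⟦ X x ∧ (X u ∧ F x u) ⟧
      leaving x u with X x in Xx | X u in Xu
      ... | false | _ = z≤n
      ... | true | true = ≤-reflexive (*-identityˡ _)
      ... | true | false with F x u in Fxu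
      ...   | false = z≤n
      ...   | true with blocked x u Xx Xu
      ...     | res rewrite Fxu | sym E u x | F⊆E x u Fxu = ⊥-elim (true≢false (∨-trueʳ {not (F u x)} refl) res)

      entering-sum : inner + cut ≤ ∑ (λ x → ⟦ X x ⟧ * inflow F x)
      entering-sum = begin
        inner + cut
          ≡⟨ ∑-distrib-+ {n} (λ x → ∑ (λ u → ⟦ X x ∧ (X u ∧ F u x) ⟧)) _ ⟨
        ∑ (λ x → ∑ (λ u → ⟦ X x ∧ (X u ∧ F u x) ⟧) + ∑ (λ u → ⟦ X x ∧ (adj E x u ∧ not (X u)) ⟧))
          ≡⟨ sum-cong-≗ {n} (λ x → ∑-distrib-+ {n} (λ u → ⟦ X x ∧ (X u ∧ F u x) ⟧) _) ⟨
        ∑ (λ x → ∑ (λ u → ⟦ X x ∧ (X u ∧ F u x) ⟧ + ⟦ X x ∧ (adj E x u ∧ not (X u)) ⟧))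
          ≤⟨ ∑-mono {n} (λ x → ∑-mono {n} (entering x)) ⟩
        ∑ (λ x → ∑ (λ u → ⟦ X x ⟧ * ⟦ F u x ⟧))
          ≡⟨ sum-cong-≗ {n} (λ x → ∑-*ˡ ⟦ X x ⟧ (λ u → ⟦ F u x ⟧)) ⟩
        ∑ (λ x → ⟦ X x ⟧ * inflow F x) ∎

      leaving-sum : ∑ (λ x → ⟦ X x ⟧ * outflow F x) ≤ inner
      leaving-sum = begin
        ∑ (λ x → ⟦ X x ⟧ * outflow F x)
          ≡⟨ sum-cong-≗ {n} (λ x → ∑-*ˡ ⟦ X x ⟧ (λ u → ⟦ F x u ⟧)) ⟨
        ∑ (λ x → ∑ (λ u → ⟦ X x ⟧ * ⟦ F x u ⟧))
          ≤⟨ ∑-mono {n} (λ x → ∑-mono {n} (leaving x)) ⟩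
        ∑ (λ x → ∑ (λ u → ⟦ X x ∧ (X u ∧ F x u) ⟧))
          ≡⟨ ∑-comm {n} {n} (λ x u → ⟦ X x ∧ (X u ∧ F x u) ⟧) ⟩
        ∑ (λ u → ∑ (λ x → ⟦ X x ∧ (X u ∧ F x u) ⟧))
          ≡⟨ sum-cong-≗ {n} (λ u → sum-cong-≗ {n} λ x → cong ⟦_⟧ (swap (X x) (X u) (F x u))) ⟩
        inner ∎
        where
        swap : ∀ p q s → p ∧ (q ∧ s) ≡ q ∧ (p ∧ s)
        swap true  q s = refl
        swap false q s = ≡.sym (∧-zeroʳ q)

      excess : ∀ x → ⟦ X x ⟧ * inflow F x ≤ ⟦ X x ⟧ * outflow F x + ⟦ X x ⟧
      excess x with X x in Xx
      ... | false = z≤n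
      ... | true rewrite +-identityʳ (inflow F x) | +-identityʳ (outflow F x) with bal x (X⊆D x Xx)
      ...   | inj₁ e rewrite e = m≤m+n _ 1
      ...   | inj₂ e rewrite e = ≤-reflexive (+-comm 1 _)

      -- The root has excess 0 instead of 1; this makes the total excess strictly smaller than the
      -- size of `X` and contradicts expansion.
      excess-root : ⟦ X r ⟧ * inflow F r < ⟦ X r ⟧ * outflow F r + ⟦ X r ⟧
      excess-root rewrite Xr | in≡out = ≤-reflexive (+-comm 1 _)

      boundary<count : cut < count X
      boundary<count = +-cancelˡ-< inner _ _ (begin-strict
        inner + cut ≤⟨ entering-sum ⟩
        ∑ (λ x → ⟦ X x ⟧ * inflow F x) <⟨ ∑-mono-< {n} excess r excess-root ⟩
        ∑ (λ x → ⟦ X x ⟧ * outflow F x + ⟦ X x ⟧) ≡⟨ ∑-distrib-+ {n} (λ x → ⟦ X x ⟧ * outflow F x) (⟦_⟧ ∘ X) ⟩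
        ∑ (λ x → ⟦ X x ⟧ * outflow F x) + count X ≤⟨ +-monoˡ-≤ (count X) leaving-sum ⟩
        inner + count X ∎)

    count-insert : ∀ X x → X x ≡ false → count (λ v → X v ∨ (v == x)) ≡ suc (count X)
    count-insert X x ¬Xx = trans (sum-cong-≗ {n} pointwise)
      (trans (∑-distrib-+ {n} (λ v → ⟦ v == x ⟧) (⟦_⟧ ∘ X)) (cong (_+ count X) (count-≡ x)))
      where
      pointwise : ∀ v → ⟦ X v ∨ (v == x) ⟧ ≡ ⟦ v == x ⟧ + ⟦ X v ⟧
      pointwise v with v ≟ x
      ... | yes refl rewrite ¬Xx = refl
      ... | no _ rewrite ∨-identityʳ (X v) = refl

    -- By `closed-impossible` some residual step enters every set of dirty vertices that contains
    -- the unserved root. The set absorbs the starting points of such steps until one of them is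
    -- clean. The fuel `k` bounds the number of dirty vertices outside `X`, so it cannot run out
    -- first.
    search : ∀ F r → InE F → Balanced F → inflow F r ≡ outflow F r →
      ∀ k X → count D ≤ count X + k → Grown F r X → (∀ v → X v ≡ true → D v ≡ true) →
      ∃ λ Y → ∃ λ z → Grown F r Y × Y z ≡ true × D z ≡ false
    search F r F⊆E bal in≡out k X bound g X⊆D
      with any? (λ x → any? (λ y → Unblocked F X x y Bool.≟ true))
    ... | no closed = ⊥-elim (closed-impossible F X r F⊆E bal X⊆D (grown-root g) in≡out
            λ x y → ¬-not λ h → closed (x , y , h))
    ... | yes (x , y , h) with ∧-true {not (X x)} h
    ...   | ¬Xx , h′ with ∧-true {X y} h′
    ...     | Xy , res with true? (D x)
    ...       | inj₂ ¬Dx =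
      _ , x , grow x y g (not-true⁻ ¬Xx) Xy res , ∨-trueʳ {X x} (==-refl x) , ¬Dx
    ...       | inj₁ Dx = continue k bound
      where
      X′ : Fin n → Bool
      X′ v = X v ∨ (v == x)
      X′⊆D : ∀ v → X′ v ≡ true → D v ≡ true
      X′⊆D v h with ∨-true {X v} h
      ... | inj₁ Xv = X⊆D v Xv
      ... | inj₂ v=x rewrite ==⇒≡ v x v=x = Dx
      size : count X′ ≡ suc (count X)
      size = count-insert X x (not-true⁻ ¬Xx)
      continue : ∀ k → count D ≤ count X + k →
        ∃ λ Y → ∃ λ z → Grown F r Y × Y z ≡ true × D z ≡ false
      continue zero bound = contradiction (≤-trans (count-mono X′⊆D) bound)
        (<⇒≱ (≤-reflexive (trans (cong suc (+-identityʳ _)) (≡.sym size))))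
      continue (suc k) bound = search F r F⊆E bal in≡out k X′
        (≤-trans bound (≤-reflexive (trans (+-suc (count X) k) (cong (_+ k) (≡.sym size)))))
        (grow x y g (not-true⁻ ¬Xx) Xy res) X′⊆D

    Served : ArcSet → Fin n → Set
    Served F v = inflow F v ≡ suc (outflow F v)

    -- Rerouting from the clean vertex `z` found by `search` raises the excess of `r` by one and
    -- lowers only that of `z`. As `z` is clean, the excess at every dirty vertex other than `r` is
    -- unchanged.
    augment : ∀ F r → InE F → Balanced F → D r ≡ true → inflow F r ≡ outflow F r →
      ∃ λ G → InE G × Balanced G × Served G r × (∀ v → D v ≡ true → Served F v → Served G v)
    augment F r F⊆E bal Dr in≡out
      with Y , z , g , Yz , ¬Dz ← search F r F⊆E bal in≡out (count D) (_== r) (m≤n+m _ _) root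
             (λ v v=r → trans (cong D (==⇒≡ v r v=r)) Dr)
      with G , G⊆E , s , _ ← reroute F⊆E g z Yz
      = G , G⊆E , balanced , served-r , served
      where
      served-r : Served G r
      served-r with eq ← s r rewrite ≢⇒==-false (λ r≡z → true≢false Dr (trans (cong D r≡z) ¬Dz)) | ==-refl r
        | in≡out = +-cancelʳ-≡ (outflow F r) _ _ (trans (≡.sym (+-identityʳ _)) (trans eq (rearrange (outflow F r) _)))
        where
        rearrange : ∀ o o′ → o + o′ + 1 ≡ suc o′ + o
        rearrange = solve-∀
      other : ∀ v → D v ≡ true → v ≢ r → inflow G v + outflow F v ≡ inflow F v + outflow G v
      other v Dv v≢r with eq ← s v rewrite ≢⇒==-false (λ v≡z → true≢false Dv (trans (cong D v≡z) ¬Dz))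
        | ≢⇒==-false v≢r = trans (≡.sym (+-identityʳ _)) (trans eq (+-identityʳ _))
      served : ∀ v → D v ≡ true → Served F v → Served G v
      served v Dv Fv with v ≟ r
      ... | yes refl = served-r
      ... | no v≢r with eq ← other v Dv v≢r rewrite Fv =
        +-cancelʳ-≡ (outflow F v) _ _ (trans eq (cong suc (+-comm (outflow F v) _)))
      balanced : Balanced G
      balanced v Dv with v ≟ r
      ... | yes refl = inj₂ served-r
      ... | no v≢r with bal v Dv
      ...   | inj₂ Fv = inj₂ (served v Dv Fv)
      ...   | inj₁ Fv with eq ← other v Dv v≢r rewrite Fv =
        inj₁ (+-cancelʳ-≡ (outflow F v) _ _ (trans eq (+-comm (outflow F v) _)))

    serve-all : (vs : List (Fin n)) →
      ∃ λ F → InE F × Balanced F × (∀ v → v ∈ vs → D v ≡ true → Served F v)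
    serve-all [] = (λ _ _ → false) , (λ _ _ ()) ,
      (λ v _ → inj₁ refl) , λ v ()
    serve-all (r ∷ vs) with F , F⊆E , bal , served ← serve-all vs with true? (D r)
    ... | inj₂ ¬Dr = F , F⊆E , bal , λ where
      v (here refl) Dv → ⊥-elim (true≢false Dv ¬Dr)
      v (there v∈) Dv → served v v∈ Dv
    ... | inj₁ Dr with bal r Dr
    ...   | inj₂ sr = F , F⊆E , bal , λ where
      v (here refl) Dv → sr
      v (there v∈) Dv → served v v∈ Dv
    ...   | inj₁ in≡out with G , G⊆E , balG , sr , keep ← augment F r F⊆E bal Dr in≡out =
      G , G⊆E , balG , λ where
      v (here refl) Dv → sr
      v (there v∈) Dv → keep v Dv (served v v∈ Dv)

    unit-demand-flow : ∃ λ F → InE F × (∀ v → D v ≡ true → Served F v)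
    unit-demand-flow with F , F⊆E , _ , served ← serve-all (allFin n) =
      F , F⊆E , λ v → served v (∈-allFin v)

-- Matching two lists by position.

assoc : ∀ {m} → List (Fin m) → List (Fin m) → Fin m → Fin m
assoc (x ∷ xs) (y ∷ ys) e = if e == x then y else assoc xs ys e
-- A default that keeps the function total; `assoc-matching` concerns only members of `xs`, with
-- lists of equal length.
assoc _ _ e = e

-- As `ys` has no repetitions, looking up the partner of `e` in the reverse direction stops at the
-- position of `e`.
assoc-matching : ∀ {m} {xs ys : List (Fin m)} → Unique xs → Unique ys → length xs ≡ length ys →
  ∀ {e} → e ∈ xs → assoc xs ys e ∈ ys × assoc ys xs (assoc xs ys e) ≡ e
assoc-matching {xs = x ∷ xs} {y ∷ ys} (x∉ ∷ ux) (y∉ ∷ uy) len {e} e∈ with e ≟ x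
... | yes refl rewrite ==-refl y = here refl , refl
... | no e≢x with e∈
...   | here e≡x = contradiction e≡x e≢x
...   | there e∈xs with assoc-matching ux uy (suc-injective len) e∈xs
...     | f∈ys , inv rewrite ≢⇒==-false (λ f≡y → All.lookup y∉ f∈ys (≡.sym f≡y)) = there f∈ys , inv

-- Injections of finite sets and the cyclic successor.

injective⇒surjective : ∀ {N} (τ : Fin N → Fin N) → (∀ {x y} → τ x ≡ τ y → x ≡ y) →
  ∀ i → ∃ λ y → τ y ≡ i
injective⇒surjective {suc N} τ inj i with any? (λ y → τ y ≟ i)
... | yes found = found
... | no none = contradiction
  (Fin.injective⇒≤ {f = λ y → punchOut (missed y)}
    (λ {x} {y} eq → inj (Fin.punchOut-injective (missed x) (missed y) eq)))
  1+n≰n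
  where
  missed : ∀ y → i ≢ τ y
  missed y i≡τy = none (y , ≡.sym i≡τy)

-- A section `τ` of `σ` is injective, hence surjective by finiteness, and therefore a two-sided
-- inverse.
surjective⇒injective : ∀ {N} (σ : Fin N → Fin N) → (∀ y → ∃ λ i → σ i ≡ y) →
  ∀ i j → σ i ≡ σ j → i ≡ j
surjective⇒injective σ surj i j σi≡σj = trans (≡.sym (τ-σ i)) (trans (cong τ σi≡σj) (τ-σ j))
  where
  τ : Fin _ → Fin _
  τ y = proj₁ (surj y)
  τ-injective : ∀ {x y} → τ x ≡ τ y → x ≡ y
  τ-injective {x} {y} eq = trans (≡.sym (proj₂ (surj x))) (trans (cong σ eq) (proj₂ (surj y)))
  τ-σ : ∀ i → τ (σ i) ≡ i
  τ-σ i with y , refl ← injective⇒surjective τ τ-injective i = cong τ (proj₂ (surj y))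

-- The same formula as `nextArc` in the construction; `CyclicNext` is the relation that occurs in
-- `Hamiltonian`.
cyclicNext : ∀ {N} → Fin N → Fin N → Bool
cyclicNext {N} i j = (suc (toℕ i) ≡ᵇ toℕ j) ∨ ((suc (toℕ i) ≡ᵇ N) ∧ (toℕ j ≡ᵇ 0))

CyclicNext : ∀ {N} → Fin N → Fin N → Set
CyclicNext {N} i j = suc (toℕ i) ≡ toℕ j ⊎ (suc (toℕ i) ≡ N × toℕ j ≡ 0)

≡ᵇ-true⁻ : ∀ {x y} → (x ≡ᵇ y) ≡ true → x ≡ y
≡ᵇ-true⁻ {x} {y} h = ≡ᵇ⇒≡ x y (Equivalence.from T-≡ h)

≡ᵇ-true⁺ : ∀ {x y} → x ≡ y → (x ≡ᵇ y) ≡ true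
≡ᵇ-true⁺ {x} {y} h = Equivalence.to T-≡ (≡⇒≡ᵇ x y h)

cyclicNext⁻ : ∀ {N} (i j : Fin N) → cyclicNext i j ≡ true → CyclicNext i j
cyclicNext⁻ i j h with ∨-true {suc (toℕ i) ≡ᵇ toℕ j} h
... | inj₁ e = inj₁ (≡ᵇ-true⁻ e)
... | inj₂ e with ∧-true e
...   | p , q = inj₂ (≡ᵇ-true⁻ p , ≡ᵇ-true⁻ q)

cyclicNext⁺ : ∀ {N} (i j : Fin N) → CyclicNext i j → cyclicNext i j ≡ true
cyclicNext⁺ i j (inj₁ e) = ∨-trueˡ (≡ᵇ-true⁺ e)
cyclicNext⁺ i j (inj₂ (e , e′)) = ∨-trueʳ {suc (toℕ i) ≡ᵇ toℕ j} (∧-true⁺ (≡ᵇ-true⁺ e) (≡ᵇ-true⁺ e′))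

CyclicNext-functional : ∀ {N} {i j k : Fin N} → CyclicNext i j → CyclicNext i k → j ≡ k
CyclicNext-functional (inj₁ p) (inj₁ q) = toℕ-injective (trans (≡.sym p) q)
CyclicNext-functional {k = k} (inj₂ (p , _)) (inj₁ q) = contradiction (trans (≡.sym q) p) (<⇒≢ (toℕ<n k))
CyclicNext-functional {j = j} (inj₁ p) (inj₂ (q , _)) = contradiction (trans (≡.sym p) q) (<⇒≢ (toℕ<n j))
CyclicNext-functional (inj₂ (_ , p)) (inj₂ (_ , q)) = toℕ-injective (trans p (≡.sym q))

CyclicNext-injective : ∀ {N} {i j k : Fin N} → CyclicNext i k → CyclicNext j k → i ≡ j
CyclicNext-injective (inj₁ p) (inj₁ q) = toℕ-injective (suc-injective (trans p (≡.sym q)))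
CyclicNext-injective (inj₁ p) (inj₂ (_ , q)) = contradiction (trans p q) λ ()
CyclicNext-injective (inj₂ (_ , p)) (inj₁ q) = contradiction (trans q p) λ ()
CyclicNext-injective (inj₂ (p , _)) (inj₂ (q , _)) = toℕ-injective (suc-injective (trans p (≡.sym q)))

CyclicNext-irreflexive : ∀ {N} → 2 ≤ N → (i : Fin N) → ¬ CyclicNext i i
CyclicNext-irreflexive 2≤N i (inj₁ p) = 1+n≢n p
CyclicNext-irreflexive 2≤N i (inj₂ (p , q)) rewrite q = contradiction 2≤N (<⇒≱ (s≤s (≤-reflexive (≡.sym p))))

count-≤1 : ∀ {n} (f : Fin n → Bool) → (∀ x y → f x ≡ true → f y ≡ true → x ≡ y) → count f ≤ 1
count-≤1 f unique with any? (λ x → f x Bool.≟ true)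
... | yes (x , fx) = count-≤-length f [ x ] λ y fy → here (unique y x fy fx)
... | no none = ≤-trans (count-≤-length f [] λ y fy → contradiction (y , fy) none) z≤n

closedNbhd-self : ∀ {n} (G : Graph n) S x → lookup S x ≡ true → lookup (closedNbhd G S) x ≡ true
closedNbhd-self G S x Sx = trans (lookup∘tabulate _ x) (∨-trueˡ Sx)

closedNbhd-adj : ∀ {n} (G : Graph n) S w x → lookup S w ≡ true → adj G w x ≡ true →
  lookup (closedNbhd G S) x ≡ true
closedNbhd-adj G S w x Sw wx = trans (lookup∘tabulate _ x)
  (∨-trueʳ {lookup S x} (any-true⁺ _ (∈-allFin w) (∧-true⁺ Sw wx)))

closedNbhd⁻ : ∀ {n} (G : Graph n) S x → lookup (closedNbhd G S) x ≡ true →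
  lookup S x ≡ true ⊎ ∃ λ w → lookup S w ≡ true × adj G w x ≡ true
closedNbhd⁻ G S x h with ∨-true {lookup S x} (trans (≡.sym (lookup∘tabulate _ x)) h)
... | inj₁ Sx = inj₁ Sx
... | inj₂ h′ with w , _ , p ← any-true⁻ (λ w → lookup S w ∧ adj G w x) (allFin _) h′ = inj₂ (w , ∧-true p)

-- The Hamiltonian graph that agrees with G around S.

-- H consists of G[N_G(S)] and the cycle σ. Cycle edges meeting N_G(S) lie in G, so passing
-- from G to H does not change N(S), and only the cycle adds to degrees outside N_G(S).
module CycleCompletion {N : ℕ} (G : Graph N) (S : Subset N) (D : ℕ) (2≤D : 2 ≤ D) (3≤N : 3 ≤ N)
  (G∈C : InC D G) (σ : Fin N → Fin N) (σ-injective : ∀ i j → σ i ≡ σ j → i ≡ j)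
  (σ-edges : ∀ i j → CyclicNext i j →
    lookup (closedNbhd G S) (σ i) ≡ true ⊎ lookup (closedNbhd G S) (σ j) ≡ true →
    adj G (σ i) (σ j) ≡ true) where

  near : Fin N → Bool
  near = lookup (closedNbhd G S)

  onCycle : Fin N → Fin N → Bool
  onCycle x y = any (λ i → any (λ j → cyclicNext i j ∧ ((σ i == x) ∧ (σ j == y))) (allFin N)) (allFin N)

  onCycle⁺ : ∀ i j → CyclicNext i j → onCycle (σ i) (σ j) ≡ true
  onCycle⁺ i j next = any-true⁺ _ (∈-allFin i) (any-true⁺ _ (∈-allFin j)
    (∧-true⁺ (cyclicNext⁺ i j next) (∧-true⁺ (==-refl (σ i)) (==-refl (σ j)))))

  onCycle⁻ : ∀ x y → onCycle x y ≡ true → ∃ λ i → ∃ λ j → CyclicNext i j × σ i ≡ x × σ j ≡ y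
  onCycle⁻ x y h with i , _ , h′ ← any-true⁻ (λ i → any (λ j → cyclicNext i j ∧ ((σ i == x) ∧ (σ j == y))) (allFin N)) (allFin N) h
    with j , _ , p ← any-true⁻ (λ j → cyclicNext i j ∧ ((σ i == x) ∧ (σ j == y))) (allFin N) h′
    with next , p′ ← ∧-true {cyclicNext i j} p
    with σi , σj ← ∧-true {σ i == x} p′
    = i , j , cyclicNext⁻ i j next , ==⇒≡ (σ i) x σi , ==⇒≡ (σ j) y σj

  onCycle-functional : ∀ x y z → onCycle x y ≡ true → onCycle x z ≡ true → y ≡ z
  onCycle-functional x y z xy xz
    with i , j , p , refl , refl ← onCycle⁻ x y xy | i′ , k , q , e , refl ← onCycle⁻ x z xz
    rewrite σ-injective i′ i e = cong σ (CyclicNext-functional p q)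

  onCycle-injective : ∀ x y z → onCycle x z ≡ true → onCycle y z ≡ true → x ≡ y
  onCycle-injective x y z xz yz
    with i , j , p , refl , refl ← onCycle⁻ x z xz | k , j′ , q , refl , e ← onCycle⁻ y z yz
    rewrite σ-injective j′ j e = cong σ (CyclicNext-injective p q)

  onCycle-irreflexive : ∀ x → onCycle x x ≡ false
  onCycle-irreflexive x = ¬-not λ h → case onCycle⁻ x x h of λ where
    (i , j , p , refl , e) → CyclicNext-irreflexive (<⇒≤ 3≤N) i (subst (CyclicNext i) (σ-injective j i e) p)

  onCycle-near : ∀ x y → onCycle x y ≡ true → near x ≡ true ⊎ near y ≡ true → adj G x y ≡ true
  onCycle-near x y h n with i , j , p , refl , refl ← onCycle⁻ x y h = σ-edges i j p n

  kept : Fin N → Fin N → Bool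
  kept x y = near x ∧ (near y ∧ adj G x y)

  kept-comm : ∀ x y → kept x y ≡ kept y x
  kept-comm x y with near x | near y
  ... | true  | true  = sym G x y
  ... | true  | false = refl
  ... | false | true  = refl
  ... | false | false = refl

  H : Graph N
  H = record
    { adj = λ x y → kept x y ∨ (onCycle x y ∨ onCycle y x)
    ; sym = λ x y → cong₂ _∨_ (kept-comm x y) (∨-comm (onCycle x y) (onCycle y x))
    }

  H⇒G : ∀ x y → near x ≡ true ⊎ near y ≡ true → adj H x y ≡ true → adj G x y ≡ true
  H⇒G x y n h with ∨-true {kept x y} h
  ... | inj₁ k = proj₂ (∧-true {near y} (proj₂ (∧-true {near x} k)))
  ... | inj₂ c with ∨-true {onCycle x y} c
  ...   | inj₁ xy = onCycle-near x y xy n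
  ...   | inj₂ yx = trans (sym G x y) (onCycle-near y x yx (Sum.swap n))

  G⇒H : ∀ x y → near x ≡ true → near y ≡ true → adj G x y ≡ true → adj H x y ≡ true
  G⇒H x y nx ny xy = ∨-trueˡ (∧-true⁺ nx (∧-true⁺ ny xy))

  -- A vertex in N(S) has only edges of `G`. Any other vertex keeps at most its two cycle edges, and
  -- `2 ≤ D`.
  H∈C : InC D H
  proj₁ H∈C v rewrite proj₁ G∈C v | onCycle-irreflexive v | ∧-zeroʳ (near v) | ∧-zeroʳ (near v) = refl
  proj₂ H∈C v with true? (near v)
  ... | inj₁ nv = ≤-trans (≤-reflexive (∣tabulate∣ (adj H v)))
          (≤-trans (count-mono (λ w → H⇒G v w (inj₁ nv)))
            (≤-trans (≤-reflexive (≡.sym (∣tabulate∣ (adj G v)))) (proj₂ G∈C v)))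
  ... | inj₂ ¬nv = begin
    ∣ tabulate (adj H v) ∣                       ≡⟨ ∣tabulate∣ (adj H v) ⟩
    count (adj H v)                              ≤⟨ ∑-mono pointwise ⟩
    ∑ (λ w → ⟦ onCycle v w ⟧ + ⟦ onCycle w v ⟧)  ≡⟨ ∑-distrib-+ (λ w → ⟦ onCycle v w ⟧) (λ w → ⟦ onCycle w v ⟧) ⟩
    count (onCycle v) + count (λ w → onCycle w v)
      ≤⟨ +-mono-≤ (count-≤1 (onCycle v) (onCycle-functional v))
                  (count-≤1 (λ w → onCycle w v) λ x y → onCycle-injective x y v) ⟩
    2                                            ≤⟨ 2≤D ⟩
    D                                            ∎
    where
    open ≤-Reasoning
    pointwise : ∀ w → ⟦ adj H v w ⟧ ≤ ⟦ onCycle v w ⟧ + ⟦ onCycle w v ⟧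
    pointwise w rewrite ¬nv with onCycle v w | onCycle w v
    ... | true  | true  = s≤s z≤n
    ... | true  | false = ≤-refl
    ... | false | true  = ≤-refl
    ... | false | false = ≤-refl

  H-hamiltonian : Hamiltonian H
  H-hamiltonian = 3≤N , σ , σ-injective , λ i j next →
    ∨-trueʳ {kept (σ i) (σ j)} (∨-trueˡ (onCycle⁺ i j next))

  near⇒nearH : ∀ x → near x ≡ true → lookup (closedNbhd H S) x ≡ true
  near⇒nearH x nx with closedNbhd⁻ G S x nx
  ... | inj₁ Sx = closedNbhd-self H S x Sx
  ... | inj₂ (w , Sw , wx) = closedNbhd-adj H S w x Sw (G⇒H w x (closedNbhd-self G S w Sw) nx wx)

  nearH⇒near : ∀ x → lookup (closedNbhd H S) x ≡ true → near x ≡ true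
  nearH⇒near x nx with closedNbhd⁻ H S x nx
  ... | inj₁ Sx = closedNbhd-self G S x Sx
  ... | inj₂ (w , Sw , wx) = closedNbhd-adj G S w x Sw (H⇒G w x (inj₁ (closedNbhd-self G S w Sw)) wx)

  H-local-iso : LocalIso G S H S id
  H-local-iso = near⇒nearH , (λ _ _ _ _ → id) , (λ y ny → y , nearH⇒near y ny , refl) ,
    (λ x y nx ny → same x y nx ny (true? (adj G x y))) , λ _ _ → refl
    where
    same : ∀ x y → near x ≡ true → near y ≡ true → adj G x y ≡ true ⊎ adj G x y ≡ false →
      adj G x y ≡ adj H x y
    same x y nx ny (inj₁ xy) = trans xy (≡.sym (G⇒H x y nx ny xy))
    same x y nx ny (inj₂ ¬xy) = trans ¬xy (≡.sym (¬-not λ h → true≢false (H⇒G x y (inj₁ nx) h) ¬xy))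

-- Paths recorded with their vertex lists, and cycles made from them.

data Path {A : Set} (R : A → A → Set) : A → A → List A → Set where
  stop : ∀ {x} → Path R x x [ x ]
  _∷_  : ∀ {x y z l} → R x y → Path R y z l → Path R x z (x ∷ l)

module _ {A : Set} {R : A → A → Set} where

  append : ∀ {x y x′ y′ l l′} → Path R x y l → R y x′ → Path R x′ y′ l′ → Path R x y′ (l ++ l′)
  append stop    r q = r ∷ q
  append (s ∷ p) r q = s ∷ append p r q

  chain : ∀ {k} (x y : Fin (suc k) → A) (l : Fin (suc k) → List A) →
    (∀ i → Path R (x i) (y i) (l i)) → (∀ i → R (y (inject₁ i)) (x (suc i))) →
    Path R (x zero) (y (fromℕ k)) (concat (List.tabulate l))
  chain {zero}  x y l p r = subst (Path R _ _) (≡.sym (List.++-identityʳ (l zero))) (p zero)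
  chain {suc k} x y l p r = append (p zero) (r zero) (chain (x ∘ suc) (y ∘ suc) (l ∘ suc) (p ∘ suc) (r ∘ suc))

  lookup-first : ∀ {x y l} → Path R x y l → ∀ i → toℕ i ≡ 0 → List.lookup l i ≡ x
  lookup-first stop    zero _ = refl
  lookup-first (_ ∷ _) zero _ = refl

  lookup-last : ∀ {x y l} → Path R x y l → ∀ i → suc (toℕ i) ≡ length l → List.lookup l i ≡ y
  lookup-last stop          zero    _ = refl
  lookup-last (_ ∷ (_ ∷ _)) zero    ()
  lookup-last (_ ∷ p)       (suc i) e = lookup-last p i (suc-injective e)

  lookup-step : ∀ {x y l} → Path R x y l → ∀ i j → suc (toℕ i) ≡ toℕ j →
    R (List.lookup l i) (List.lookup l j)
  lookup-step stop    zero    zero    ()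
  lookup-step (r ∷ p) zero    (suc j) e = subst (R _) (≡.sym (lookup-first p j (≡.sym (suc-injective e)))) r
  lookup-step (r ∷ p) (suc i) (suc j) e = lookup-step p i j (suc-injective e)

  lookup-cyclic : ∀ {x y l} → Path R x y l → R y x → ∀ i j → CyclicNext i j →
    R (List.lookup l i) (List.lookup l j)
  lookup-cyclic p r i j (inj₁ e) = lookup-step p i j e
  lookup-cyclic p r i j (inj₂ (e , e′)) =
    subst₂ R (≡.sym (lookup-last p i e)) (≡.sym (lookup-first p j e′)) r

-- A list of length N containing all N elements contains each exactly once.
closed-path⇒cycle : ∀ {N} {A : Set} {R : A → A → Set} (enc : A → Fin N) →
  ∀ {x y l} → Path R x y l → R y x → length l ≡ N → (∀ i → ∃ λ z → z ∈ l × enc z ≡ i) →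
  ∃ λ (σ : Fin N → A) → (∀ i j → enc (σ i) ≡ enc (σ j) → i ≡ j) ×
    (∀ i j → CyclicNext i j → R (σ i) (σ j))
closed-path⇒cycle enc {l = l} p r refl covers =
  List.lookup l , surjective⇒injective (enc ∘ List.lookup l) onto , lookup-cyclic p r
  where
  onto : ∀ y → ∃ λ i → enc (List.lookup l i) ≡ y
  onto y with z , z∈l , refl ← covers y = Any.index z∈l , cong enc (≡.sym (Any.lookup-index z∈l))

-- Neighbourhoods and degrees in the constructed graph.

length-concatMap-≤ : ∀ {A B : Set} (f : A → List B) k → (∀ x → length (f x) ≤ k) →
  ∀ xs → length (concatMap f xs) ≤ length xs * k
length-concatMap-≤ f k bound [] = z≤n
length-concatMap-≤ f k bound (x ∷ xs) = ≤-trans (≤-reflexive (List.length-++ (f x)))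
  (+-mono-≤ (bound x) (length-concatMap-≤ f k bound xs))

count-positive : ∀ {n} (f : Fin n → Bool) → 0 < count f → ∃ λ i → f i ≡ true
count-positive {n} f pos with i , lt ← ∑-<⇒∃< (const 0) (⟦_⟧ ∘ f) (subst (_< count f) (≡.sym (∑-zero {n} λ _ → refl)) pos)
  with f i in fi
... | true = i , fi

-- `link`, `inPort`, `outPort` and `bEdge` name the label conditions inside `gen` and unfold to
-- them.
link : Fin 31 → Fin 31 → Bool
link k k′ = (k is 23 ∧ k′ is 3) ∨ (k is 18 ∧ k′ is 8) ∨ (k is 29 ∧ k′ is 9) ∨ (k is 24 ∧ k′ is 14)

inPort outPort : Fin 31 → Fin 6 → Bool
inPort  k l = (k is 5 ∧ l is 1) ∨ (k is 12 ∧ l is 6)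
outPort k l = (k is 23 ∧ l is 3) ∨ (k is 24 ∧ l is 4)

bEdge : Fin 6 → Fin 6 → Bool
bEdge l l′ = (l is 1 ∧ l′ is 2) ∨ (l is 2 ∧ l′ is 3) ∨ (l is 4 ∧ l′ is 5) ∨ (l is 5 ∧ l′ is 6)

wrap : Fin 31 → Fin 31 → Bool
wrap k k′ = k is 31 ∧ k′ is 1

pAdj : Fin 31 → Fin 31 → Bool
pAdj k k′ = pEdge k k′ ∨ pEdge k′ k

bAdj : Fin 6 → Fin 6 → Bool
bAdj l l′ = bEdge l l′ ∨ bEdge l′ l

-- At a vertex of G_E: the neighbours other than link edges, and the number of
-- labels joined by link edges, each of which accounts for d neighbours.
aFixed aLinked : Fin 31 → ℕ
aFixed k = count (pAdj k) + count (wrap k) + count (λ k′ → wrap k′ k) + count (inPort k) + count (outPort k)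
aLinked k = count (link k) + count (λ k′ → link k′ k)

bFixed bLinked : Fin 6 → ℕ
bFixed l = count (bAdj l)
bLinked l = count (λ k → inPort k l) + count (λ k → outPort k l)

-- A check over all 31 labels. A label with a link pattern has `d` neighbours along it and at most 3
-- others; a label without one has at most 5, which is at most `d + 3` because `2 ≤ d`.
aBound : ∀ k → (aLinked k ≡ 0 × aFixed k ≤ 5) ⊎ (aLinked k ≡ 1 × aFixed k ≤ 3)
aBound = toWitness {a? = all? λ k →
  ((aLinked k ℕ.≟ 0) ×-dec (aFixed k ≤? 5)) ⊎-dec ((aLinked k ℕ.≟ 1) ×-dec (aFixed k ≤? 3))} tt

bBound : ∀ l → (bLinked l ≡ 0 × bFixed l ≤ 5) ⊎ (bLinked l ≡ 1 × bFixed l ≤ 3)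
bBound = toWitness {a? = all? λ l →
  ((bLinked l ℕ.≟ 0) ×-dec (bFixed l ≤? 5)) ⊎-dec ((bLinked l ℕ.≟ 1) ×-dec (bFixed l ≤? 3))} tt

fixed+linked-≤ : ∀ {d} → 2 ≤ d → ∀ {r q} → (q ≡ 0 × r ≤ 5) ⊎ (q ≡ 1 × r ≤ 3) → r + q * d ≤ d + 3
fixed+linked-≤ {d} 2≤d {r} (inj₁ (refl , r≤5)) rewrite +-identityʳ r = ≤-trans r≤5 (+-monoˡ-≤ 3 2≤d)
fixed+linked-≤ {d} 2≤d {r} (inj₂ (refl , r≤3)) rewrite +-identityʳ d = ≤-trans (≤-reflexive (+-comm r d)) (+-monoʳ-≤ d r≤3)

module Gadgets {n d : ℕ} (E : Graph n) (1≤n : 1 ≤ n) (2≤d : 2 ≤ d) (simple : IsSimple E)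
  (regular : Regular d E) (m : ℕ) (arc : Fin m → Fin n × Fin n) (order : IsArcOrder E m arc) where

  open Construction E m arc

  V : Set
  V = GV m n

  N : ℕ
  N = m * 31 + n * 6

  enc : V → Fin N
  enc (a i k) = combine i k ↑ˡ (n * 6)
  enc (b v l) = (m * 31) ↑ʳ combine v l

  decode-enc : ∀ z → decode (enc z) ≡ z
  decode-enc (a i k) rewrite Fin.splitAt-↑ˡ (m * 31) (combine i k) (n * 6) =
    cong (λ p → a (proj₁ p) (proj₂ p)) (Fin.remQuot-combine i k)
  decode-enc (b v l) rewrite Fin.splitAt-↑ʳ (m * 31) (n * 6) (combine v l) =
    cong (λ p → b (proj₁ p) (proj₂ p)) (Fin.remQuot-combine v l)

  enc-decode : ∀ x → enc (decode x) ≡ x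
  enc-decode x with splitAt (m * 31) x | Fin.join-splitAt (m * 31) (n * 6) x
  ... | inj₁ p | refl = cong (_↑ˡ (n * 6)) (Fin.combine-remQuot {m} 31 p)
  ... | inj₂ q | refl = cong ((m * 31) ↑ʳ_) (Fin.combine-remQuot {n} 6 q)

  degree : ∀ v → count (adj E v) ≡ d
  degree v = trans (≡.sym (∣tabulate∣ (adj E v))) (regular v)

  neighbour : ∀ v → ∃ λ w → adj E v w ≡ true
  neighbour v = count-positive (adj E v) (subst (0 <_) (≡.sym (degree v)) (<⇒≤ 2≤d))

  arc-adj : ∀ i → adj E (src i) (tgt i) ≡ true
  arc-adj = proj₁ (proj₂ order)

  adj⇒arc : ∀ {u v} → adj E u v ≡ true → ∃ λ i → arc i ≡ (u , v)
  adj⇒arc = proj₂ (proj₂ order) _ _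

  someArc : Fin m
  someArc = proj₁ (adj⇒arc (proj₂ (neighbour (fromℕ< 1≤n))))

  -- Pairs that are not edges receive the default `someArc`, so that `index` can be mapped over
  -- lists of vertices without carrying proofs of adjacency.
  index : Fin n → Fin n → Fin m
  index u v with true? (adj E u v)
  ... | inj₁ uv = proj₁ (adj⇒arc uv)
  ... | inj₂ _  = someArc

  arc-index : ∀ {u v} → adj E u v ≡ true → arc (index u v) ≡ (u , v)
  arc-index {u} {v} uv with true? (adj E u v)
  ... | inj₁ uv′ = proj₂ (adj⇒arc uv′)
  ... | inj₂ ¬uv = ⊥-elim (true≢false uv ¬uv)

  index-arc : ∀ i → index (src i) (tgt i) ≡ i
  index-arc i = proj₁ order _ _ (arc-index (arc-adj i))

  src-index : ∀ {u v} → adj E u v ≡ true → src (index u v) ≡ u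
  src-index = cong proj₁ ∘ arc-index

  tgt-index : ∀ {u v} → adj E u v ≡ true → tgt (index u v) ≡ v
  tgt-index = cong proj₂ ∘ arc-index

  tgt≢src : ∀ i → tgt i ≢ src i
  tgt≢src i eq = true≢false (subst (λ v → adj E (src i) v ≡ true) eq (arc-adj i)) (simple (src i))

  neighbours : Fin n → List (Fin n)
  neighbours v = filterᵇ (adj E v) (allFin n)

  outs ins nexts prevs : Fin _ → List (Fin m)
  outs v = map (index v) (neighbours v)
  ins v = map (λ u → index u v) (neighbours v)
  nexts i = filterᵇ (nextArc i) (allFin m)
  prevs i = filterᵇ (λ j → nextArc j i) (allFin m)

  length-outs : ∀ v → length (outs v) ≤ d
  length-outs v = ≤-reflexive (trans (List.length-map (index v) (neighbours v))
    (trans (length-filterᵇ-allFin (adj E v)) (degree v)))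

  length-ins : ∀ v → length (ins v) ≤ d
  length-ins v = ≤-reflexive (trans (List.length-map (λ u → index u v) (neighbours v))
    (trans (length-filterᵇ-allFin (adj E v)) (degree v)))

  length-nexts : ∀ i → length (nexts i) ≤ 1
  length-nexts i = ≤-trans (≤-reflexive (length-filterᵇ-allFin (nextArc i)))
    (count-≤1 (nextArc i) λ x y p q → CyclicNext-functional (cyclicNext⁻ i x p) (cyclicNext⁻ i y q))

  length-prevs : ∀ i → length (prevs i) ≤ 1
  length-prevs i = ≤-trans (≤-reflexive (length-filterᵇ-allFin (λ j → nextArc j i)))
    (count-≤1 (λ j → nextArc j i) λ x y p q → CyclicNext-injective (cyclicNext⁻ x i p) (cyclicNext⁻ y i q))

  ∈-outs : ∀ {j v} → v ≡ src j → j ∈ outs v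
  ∈-outs {j} refl = subst (_∈ outs (src j)) (index-arc j)
    (∈-map⁺ (index (src j)) (∈-filterᵇ⁺ (adj E (src j)) (∈-allFin (tgt j)) (arc-adj j)))

  ∈-ins : ∀ {j v} → tgt j ≡ v → j ∈ ins v
  ∈-ins {j} refl = subst (_∈ ins (tgt j)) (index-arc j)
    (∈-map⁺ (λ u → index u (tgt j)) (∈-filterᵇ⁺ (adj E (tgt j)) (∈-allFin (src j))
      (trans (sym E (tgt j) (src j)) (arc-adj j))))

  -- Every arc is listed among the at most `d` arcs leaving its source.
  m≤n*d : m ≤ n * d
  m≤n*d = begin
    m                               ≡⟨ trans (≡.sym (*-identityʳ m)) (≡.sym (∑-const m 1)) ⟩
    count {m} (const true)          ≤⟨ count-≤-length (const true) (concatMap outs (allFin n))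
                                         (λ i _ → ∈-concatMap⁺ outs (lose (∈-allFin (src i)) (∈-outs refl))) ⟩
    length (concatMap outs (allFin n)) ≤⟨ length-concatMap-≤ outs d length-outs (allFin n) ⟩
    length (allFin n) * d           ≡⟨ cong (_* d) (List.length-tabulate {n = n} id) ⟩
    n * d                           ∎
    where open ≤-Reasoning

  grid : (Fin 31 → Bool) → List (Fin m) → List V
  grid ks js = concatMap (λ k → map (λ j → a j k) js) (filterᵇ ks (allFin 31))

  ∈-grid : ∀ ks {js j k} → j ∈ js → ks k ≡ true → a j k ∈ grid ks js
  ∈-grid ks {js} {j} {k} j∈js ksk = ∈-concatMap⁺ (λ k → map (λ j → a j k) js)
    (lose (∈-filterᵇ⁺ ks (∈-allFin k) ksk) (∈-map⁺ (λ j → a j k) j∈js))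

  length-grid : ∀ ks {js c} → length js ≤ c → length (grid ks js) ≤ count ks * c
  length-grid ks {js} {c} js≤c = ≤-trans
    (length-concatMap-≤ (λ k → map (λ j → a j k) js) c
      (λ k → ≤-trans (≤-reflexive (List.length-map (λ j → a j k) js)) js≤c) (filterᵇ ks (allFin 31)))
    (≤-reflexive (cong (_* c) (length-filterᵇ-allFin ks)))

  column : (Fin 6 → Bool) → Fin n → List V
  column ls v = map (b v) (filterᵇ ls (allFin 6))

  ∈-column : ∀ ls {v l} → ls l ≡ true → b v l ∈ column ls v
  ∈-column ls {v} {l} lsl = ∈-map⁺ (b v) (∈-filterᵇ⁺ ls (∈-allFin l) lsl)

  length-column : ∀ ls v → length (column ls v) ≤ count ls
  length-column ls v = ≤-reflexive (trans (List.length-map (b v) (filterᵇ ls (allFin 6))) (length-filterᵇ-allFin ls))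

  -- Lists covering all neighbours, one for each kind of edge. Their total length bounds the degree
  -- and also the number of ends near a vertex of `S`.
  nbLists : V → List (List V)
  nbLists (a i k) = grid (pAdj k) [ i ] ∷ grid (wrap k) (nexts i) ∷ grid (λ k′ → wrap k′ k) (prevs i)
    ∷ column (inPort k) (src i) ∷ column (outPort k) (tgt i)
    ∷ grid (link k) (outs (tgt i)) ∷ grid (λ k′ → link k′ k) (ins (src i)) ∷ []
  nbLists (b v l) = column (bAdj l) v
    ∷ grid (λ k → inPort k l) (outs v) ∷ grid (λ k → outPort k l) (ins v) ∷ []

  nb : V → List V
  nb z = concat (nbLists z)

  length-++-≤ : ∀ (xs ys : List V) {p q} → length xs ≤ p → length ys ≤ q → length (xs ++ ys) ≤ p + q
  length-++-≤ xs ys xs≤p ys≤q = ≤-trans (≤-reflexive (List.length-++ xs)) (+-mono-≤ xs≤p ys≤q)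

  length-nb : ∀ z → length (nb z) ≤ d + 3
  length-nb (a i k) = ≤-trans
    (length-++-≤ (grid (pAdj k) [ i ]) _ (length-grid (pAdj k) ≤-refl)
    (length-++-≤ (grid (wrap k) (nexts i)) _ (length-grid (wrap k) (length-nexts i))
    (length-++-≤ (grid (λ k′ → wrap k′ k) (prevs i)) _ (length-grid (λ k′ → wrap k′ k) (length-prevs i))
    (length-++-≤ (column (inPort k) (src i)) _ (length-column (inPort k) (src i))
    (length-++-≤ (column (outPort k) (tgt i)) _ (length-column (outPort k) (tgt i))
    (length-++-≤ (grid (link k) (outs (tgt i))) _ (length-grid (link k) (length-outs (tgt i)))
    (length-++-≤ (grid (λ k′ → link k′ k) (ins (src i))) [] (length-grid (λ k′ → link k′ k) (length-ins (src i)))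
      (z≤n {0}))))))))
    (≤-trans (≤-reflexive (regroup (count (pAdj k)) (count (wrap k)) (count (λ k′ → wrap k′ k))
        (count (inPort k)) (count (outPort k)) (count (link k)) (count (λ k′ → link k′ k)) d))
      (fixed+linked-≤ 2≤d (aBound k)))
    where
    regroup : ∀ p w w′ i o l l′ d →
      p * 1 + (w * 1 + (w′ * 1 + (i + (o + (l * d + (l′ * d + 0)))))) ≡ p + w + w′ + i + o + (l + l′) * d
    regroup = solve-∀
  length-nb (b v l) = ≤-trans
    (length-++-≤ (column (bAdj l) v) _ (length-column (bAdj l) v)
    (length-++-≤ (grid (λ k → inPort k l) (outs v)) _ (length-grid (λ k → inPort k l) (length-outs v))
    (length-++-≤ (grid (λ k → outPort k l) (ins v)) [] (length-grid (λ k → outPort k l) (length-ins v))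
      (z≤n {0}))))
    (≤-trans (≤-reflexive (regroup (count (bAdj l)) (count (λ k → inPort k l)) (count (λ k → outPort k l)) d))
      (fixed+linked-≤ 2≤d (bBound l)))
    where
    regroup : ∀ p i o d → p + (i * d + (o * d + 0)) ≡ p + (i + o) * d
    regroup = solve-∀

  -- `gen` holds one orientation of each edge, so a single case analysis yields both memberships.
  gen⇒nb : ∀ x y → gen x y ≡ true → y ∈ nb x × x ∈ nb y
  gen⇒nb (a i k) (a j k′) h with ∨-true {i == j ∧ pEdge k k′} h
  ... | inj₁ h₁ with ∧-true {i == j} h₁
  ...   | i=j , e with refl ← ==⇒≡ i j i=j =
    ∈-concat⁺′ {xss = nbLists (a i k)} (∈-grid (pAdj k) (here refl) (∨-trueˡ e)) (here refl) ,
    ∈-concat⁺′ {xss = nbLists (a i k′)} (∈-grid (pAdj k′) (here refl) (∨-trueʳ {pEdge k′ k} e)) (here refl)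
  gen⇒nb (a i k) (a j k′) h | inj₂ h₁ with ∨-true {k is 31 ∧ k′ is 1 ∧ nextArc i j} h₁
  ... | inj₁ h₂ with p , h₃ ← ∧-true {k is 31} h₂ with q , s ← ∧-true {k′ is 1} h₃ =
    ∈-concat⁺′ {xss = nbLists (a i k)}
      (∈-grid (wrap k) (∈-filterᵇ⁺ (nextArc i) (∈-allFin j) s) (∧-true⁺ p q)) (there (here refl)) ,
    ∈-concat⁺′ {xss = nbLists (a j k′)}
      (∈-grid (λ k″ → wrap k″ k′) (∈-filterᵇ⁺ (λ i′ → nextArc i′ j) (∈-allFin i) s) (∧-true⁺ p q)) (there (there (here refl)))
  ... | inj₂ h₂ with p , e ← ∧-true {tgt i == src j} h₂ =
    ∈-concat⁺′ {xss = nbLists (a i k)}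
      (∈-grid (link k) (∈-outs (==⇒≡ (tgt i) (src j) p)) e) (there (there (there (there (there (here refl)))))) ,
    ∈-concat⁺′ {xss = nbLists (a j k′)}
      (∈-grid (λ k″ → link k″ k′) (∈-ins (==⇒≡ (tgt i) (src j) p)) e) (there (there (there (there (there (there (here refl)))))))
  gen⇒nb (a j k) (b v l) h with ∨-true {src j == v ∧ (hasIn v ∧ inPort k l)} h
  ... | inj₁ h₁ with p , h₂ ← ∧-true {src j == v} h₁ with _ , e ← ∧-true {hasIn v} h₂
    with refl ← ==⇒≡ (src j) v p =
    ∈-concat⁺′ {xss = nbLists (a j k)} (∈-column (inPort k) e) (there (there (there (here refl)))) ,
    ∈-concat⁺′ {xss = nbLists (b (src j) l)} (∈-grid (λ k → inPort k l) (∈-outs refl) e) (there (here refl))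
  ... | inj₂ h₁ with p , h₂ ← ∧-true {tgt j == v} h₁ with _ , e ← ∧-true {hasOut v} h₂
    with refl ← ==⇒≡ (tgt j) v p =
    ∈-concat⁺′ {xss = nbLists (a j k)} (∈-column (outPort k) e) (there (there (there (there (here refl))))) ,
    ∈-concat⁺′ {xss = nbLists (b (tgt j) l)} (∈-grid (λ k → outPort k l) (∈-ins refl) e) (there (there (here refl)))
  gen⇒nb (b v l) (b v′ l′) h with p , h₁ ← ∧-true {v == v′} h with _ , h₂ ← ∧-true {hasIn v} h₁
    with _ , e ← ∧-true {hasOut v} h₂ with refl ← ==⇒≡ v v′ p =
    ∈-concat⁺′ {xss = nbLists (b v l)} (∈-column (bAdj l) (∨-trueˡ e)) (here refl) ,
    ∈-concat⁺′ {xss = nbLists (b v l′)} (∈-column (bAdj l′) (∨-trueʳ {bEdge l′ l} e)) (here refl)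

  adj⇒nb : ∀ x y → adjGV x y ≡ true → y ∈ nb x
  adj⇒nb x y h with ∨-true {gen x y} h
  ... | inj₁ xy = proj₁ (gen⇒nb x y xy)
  ... | inj₂ yx = proj₂ (gen⇒nb y x yx)

  pEdge-irreflexive : ∀ k → pEdge k k ≡ false
  pEdge-irreflexive = toWitness {a? = all? λ k → pEdge k k Bool.≟ false} tt

  wrap-irreflexive : ∀ k → wrap k k ≡ false
  wrap-irreflexive = toWitness {a? = all? λ k → wrap k k Bool.≟ false} tt

  bEdge-irreflexive : ∀ l → bEdge l l ≡ false
  bEdge-irreflexive = toWitness {a? = all? λ l → bEdge l l Bool.≟ false} tt

  gen-irreflexive : ∀ z → gen z z ≢ true
  gen-irreflexive (a i k) h with ∨-true {i == i ∧ pEdge k k} h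
  ... | inj₁ h₁ = true≢false (proj₂ (∧-true {i == i} h₁)) (pEdge-irreflexive k)
  ... | inj₂ h₁ with ∨-true {k is 31 ∧ k is 1 ∧ nextArc i i} h₁
  ...   | inj₁ h₂ with p , h₃ ← ∧-true {k is 31} h₂ =
    true≢false (∧-true⁺ p (proj₁ (∧-true {k is 1} h₃))) (wrap-irreflexive k)
  ...   | inj₂ h₂ = tgt≢src i (==⇒≡ (tgt i) (src i) (proj₁ (∧-true {tgt i == src i} h₂)))
  gen-irreflexive (b v l) h with _ , h₁ ← ∧-true {v == v} h with _ , h₂ ← ∧-true {hasIn v} h₁ =
    true≢false (proj₂ (∧-true {hasOut v} h₂)) (bEdge-irreflexive l)

  GE∈C : InC (d + 3) GE
  proj₁ GE∈C x = ¬-not λ h → case ∨-true {gen (decode x) (decode x)} h of λ where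
    (inj₁ g) → gen-irreflexive (decode x) g
    (inj₂ g) → gen-irreflexive (decode x) g
  proj₂ GE∈C x = begin
    deg GE x                             ≡⟨ ∣tabulate∣ (adj GE x) ⟩
    count (adj GE x)                     ≤⟨ count-≤-length (adj GE x) (map enc (nb (decode x))) covered ⟩
    length (map enc (nb (decode x)))     ≡⟨ List.length-map enc (nb (decode x)) ⟩
    length (nb (decode x))               ≤⟨ length-nb (decode x) ⟩
    d + 3                                ∎
    where
    open ≤-Reasoning
    covered : ∀ y → adj GE x y ≡ true → y ∈ map enc (nb (decode x))
    covered y h = subst (_∈ map enc (nb (decode x))) (enc-decode y)
      (∈-map⁺ enc (adj⇒nb (decode x) (decode y) h))

  -- Dirty vertices and their number.

  ends : V → List (Fin n)
  ends (a i k) = src i ∷ tgt i ∷ []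
  ends (b v l) = [ v ]

  module Dirty (S : Subset N) where

    endsNear : V → List (Fin n)
    endsNear z = concatMap ends (z ∷ nb z)

    dirtyList : List (Fin n)
    dirtyList = concatMap (endsNear ∘ decode) (filterᵇ (lookup S) (allFin N))

    dirty : Fin n → Bool
    dirty v = any (_== v) dirtyList

    -- A vertex of `S` and its at most `d + 3` neighbours have at most two ends each.
    count-dirty : count dirty ≤ ∣ S ∣ * ((d + 4) * 2)
    count-dirty = begin
      count dirty        ≤⟨ count-≤-length dirty dirtyList member ⟩
      length dirtyList   ≤⟨ length-concatMap-≤ (endsNear ∘ decode) ((d + 4) * 2) (length-endsNear ∘ decode) (filterᵇ (lookup S) (allFin N)) ⟩
      length (filterᵇ (lookup S) (allFin N)) * ((d + 4) * 2)
                         ≡⟨ cong (_* ((d + 4) * 2)) (trans (length-filterᵇ-allFin (lookup S)) (≡.sym (∣∣≡count S))) ⟩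
      ∣ S ∣ * ((d + 4) * 2) ∎
      where
      open ≤-Reasoning
      length-ends : ∀ z → length (ends z) ≤ 2
      length-ends (a i k) = ≤-refl
      length-ends (b v l) = s≤s z≤n
      length-endsNear : ∀ z → length (endsNear z) ≤ (d + 4) * 2
      length-endsNear z = ≤-trans (length-concatMap-≤ ends 2 length-ends (z ∷ nb z))
        (*-monoˡ-≤ 2 (≤-trans (s≤s (length-nb z)) (≤-reflexive (≡.sym (+-suc d 3)))))
      member : ∀ v → dirty v ≡ true → v ∈ dirtyList
      member v h with u , u∈ , e ← any-true⁻ (_== v) dirtyList h = subst (_∈ dirtyList) (==⇒≡ u v e) u∈

    witness : ∀ {v z} w → lookup S w ≡ true → z ∈ decode w ∷ nb (decode w) → v ∈ ends z → dirty v ≡ true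
    witness {v} w Sw z∈ v∈ = any-true⁺ (_== v) (∈-concatMap⁺ (endsNear ∘ decode)
      (lose (∈-filterᵇ⁺ (lookup S) (∈-allFin w) Sw) (∈-concatMap⁺ ends (lose z∈ v∈)))) (==-refl v)

    near⇒dirty : ∀ z → lookup (closedNbhd GE S) (enc z) ≡ true → ∀ {v} → v ∈ ends z → dirty v ≡ true
    near⇒dirty z nz {v} v∈ with closedNbhd⁻ GE S (enc z) nz
    ... | inj₁ Sz = witness (enc z) Sz (here (≡.sym (decode-enc z))) v∈
    ... | inj₂ (w , Sw , wz) = witness w Sw (there (adj⇒nb (decode w) z
            (subst (λ y → adjGV (decode w) y ≡ true) (decode-enc z) wz))) v∈

-- Closed chains and the segments of P.

_∈?_ : ∀ {r} (k : Fin r) (ks : List (Fin r)) → Dec (k ∈ ks)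
_∈?_ = DecMembership._∈?_ _≟_

-- Injectivity is asked only on the list, since `index` is known to be injective only on edges.
unique-map : ∀ {A B : Set} (f : A → B) {xs} → (∀ {x y} → x ∈ xs → y ∈ xs → f x ≡ f y → x ≡ y) →
  Unique xs → Unique (map f xs)
unique-map f inj [] = []
unique-map f inj (x∉ ∷ u) =
  All.map⁺ (All.tabulate λ y∈ eq → All.lookup x∉ y∈ (inj (here refl) (there y∈) eq)) ∷
  unique-map f (λ x∈ y∈ → inj (there x∈) (there y∈)) u

length-concat-tabulate : ∀ {k} {A : Set} (f : Fin k → List A) →
  length (concat (List.tabulate f)) ≡ ∑ (length ∘ f)
length-concat-tabulate {zero}  f = refl
length-concat-tabulate {suc k} f = trans (List.length-++ (f zero)) (cong (length (f zero) +_) (length-concat-tabulate (f ∘ suc)))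

-- The argument of type `Fin k` excludes the empty chain, which would have no ends.
closed-chain : ∀ {k} {A : Set} {R : A → A → Set} → Fin k → (x y : Fin k → A) (l : Fin k → List A) →
  (∀ i → Path R (x i) (y i) (l i)) → (∀ i j → CyclicNext i j → R (y i) (x j)) →
  ∃ λ s → ∃ λ t → Path R s t (concat (List.tabulate l)) × R t s
closed-chain {suc k} _ x y l p r = _ , _ ,
  chain x y l p (λ i → r (inject₁ i) (suc i) (inj₁ (cong suc (toℕ-inject₁ i)))) ,
  r (fromℕ k) zero (inj₂ (cong suc (toℕ-fromℕ k) , refl))

-- The vertex with 1-based label L ∈ {1, …, 31}.
lab : ℕ → Fin 31
lab L = (L ∸ 1) mod 31

linked : Fin 31 → List (Fin 31) → Bool
linked k []        = true
linked k (k′ ∷ ks) = pAdj k k′ ∧ linked k′ ks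

endOf : Fin 31 → List (Fin 31) → Fin 31
endOf k []        = k
endOf k (k′ ∷ ks) = endOf k′ ks

-- P is cut into the segments 1–5, 6–11, 12–20, 21–26, 27–31. When an arc is used, its
-- segments 21–26 and 6–11 are visited from the blocks of the next and the previous arc,
-- and all segments are rerouted so that they start and end at link vertices.
segA segD segK : Bool → List (Fin 31)
segA false = map lab (1 ∷ 2 ∷ 3 ∷ 4 ∷ 5 ∷ [])
segA true  = map lab (1 ∷ 2 ∷ 5 ∷ 4 ∷ 3 ∷ [])
segD false = map lab (12 ∷ 13 ∷ 14 ∷ 15 ∷ 16 ∷ 17 ∷ 18 ∷ 19 ∷ 20 ∷ [])
segD true  = map lab (14 ∷ 13 ∷ 12 ∷ 17 ∷ 16 ∷ 15 ∷ 20 ∷ 19 ∷ 18 ∷ [])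
segK false = map lab (27 ∷ 28 ∷ 29 ∷ 30 ∷ 31 ∷ [])
segK true  = map lab (29 ∷ 28 ∷ 27 ∷ 30 ∷ 31 ∷ [])

segC segC′ segF segF′ : List (Fin 31)
segC  = map lab (6 ∷ 7 ∷ 8 ∷ 9 ∷ 10 ∷ 11 ∷ [])
segC′ = map lab (8 ∷ 7 ∷ 6 ∷ 11 ∷ 10 ∷ 9 ∷ [])
segF  = map lab (21 ∷ 22 ∷ 23 ∷ 24 ∷ 25 ∷ 26 ∷ [])
segF′ = map lab (23 ∷ 22 ∷ 21 ∷ 26 ∷ 25 ∷ 24 ∷ [])

endA startD endD startK : Bool → Fin 31
endA   u = if u then lab 3  else lab 5
startD u = if u then lab 14 else lab 12
endD   u = if u then lab 18 else lab 20
startK u = if u then lab 29 else lab 27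

ports₁ ports₂ : List (Fin 6)
ports₁ = 0F ∷ 1F ∷ 2F ∷ []
ports₂ = 3F ∷ 4F ∷ 5F ∷ []

-- Labels 6-11 and 21-26 must lie in both orders of their piece, because the order in which they are
-- visited depends on the matching and not on `u`.
Located : Bool → Fin 31 → Set
Located u k = (k ∈ segA u ⊎ k ∈ segD u ⊎ k ∈ segK u) ⊎ (k ∈ segC × k ∈ segC′) ⊎ (k ∈ segF × k ∈ segF′)

located : ∀ u k → Located u k
located u k = by-cases u k
  where
  located? : ∀ u k → Dec (Located u k)
  located? u k = ((k ∈? segA u) ⊎-dec ((k ∈? segD u) ⊎-dec (k ∈? segK u))) ⊎-dec
    (((k ∈? segC) ×-dec (k ∈? segC′)) ⊎-dec ((k ∈? segF) ×-dec (k ∈? segF′)))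
  by-cases : ∀ u k → Located u k
  by-cases false = toWitness {a? = all? (located? false)} tt
  by-cases true  = toWitness {a? = all? (located? true)} tt

port-located : ∀ l → l ∈ ports₁ ⊎ l ∈ ports₂
port-located = toWitness {a? = all? λ l → (l ∈? ports₁) ⊎-dec (l ∈? ports₂)} tt

-- The tour: matched arcs, blocks and the cyclic ordering.

module Tour {n d : ℕ} (E : Graph n) (1≤n : 1 ≤ n) (2≤d : 2 ≤ d) (simple : IsSimple E)
  (regular : Regular d E) (m : ℕ) (arc : Fin m → Fin n × Fin n) (order : IsArcOrder E m arc)
  (dirty : Fin n → Bool) (F : Fin n → Fin n → Bool)
  (F⊆E : ∀ u v → F u v ≡ true → adj E u v ≡ true)
  (served : ∀ v → dirty v ≡ true → count (λ u → F u v) ≡ suc (count (F v)))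
  (Free : GV m n → Set)
  (clean⇒Free : ∀ z {v} → v ∈ Gadgets.ends E 1≤n 2≤d simple regular m arc order z → dirty v ≡ false → Free z)
  where

  open Construction E m arc
  open Gadgets E 1≤n 2≤d simple regular m arc order
  open Flow E dirty using (inflow; outflow)

  used : Fin m → Bool
  used i = F (src i) (tgt i)

  exit-head : ∀ v → ∃ λ w → adj E v w ≡ true × (dirty v ≡ true → F v w ≡ false)
  exit-head v with true? (dirty v)
  ... | inj₂ ¬dv = proj₁ (neighbour v) , proj₂ (neighbour v) , λ dv → ⊥-elim (true≢false dv ¬dv)
  ... | inj₁ dv with w , lt ← ∑-<⇒∃< (⟦_⟧ ∘ F v) (⟦_⟧ ∘ adj E v)
    (≤-trans (≤-reflexive (≡.sym (served v dv)))
      (count-mono λ u Fuv → trans (sym E v u) (F⊆E u v Fuv)))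
    with F v w in Fvw | adj E v w in vw
  ...   | false | true = w , vw , λ _ → Fvw
  ...   | true | true = contradiction lt (<-irrefl refl)

  abstract
    exit : Fin n → Fin m
    exit v = index v (proj₁ (exit-head v))

    src-exit : ∀ v → src (exit v) ≡ v
    src-exit v = src-index (proj₁ (proj₂ (exit-head v)))

    exit-unused : ∀ v → dirty v ≡ true → used (exit v) ≡ false
    exit-unused v dv = trans (cong (λ e → F (proj₁ e) (proj₂ e)) (arc-index (proj₁ (proj₂ (exit-head v)))))
      (proj₂ (proj₂ (exit-head v)) dv)

  isExit : Fin m → Bool
  isExit i = exit (src i) == i

  isExit-exit : ∀ v → isExit (exit v) ≡ true
  isExit-exit v = trans (cong (λ w → exit w == exit v) (src-exit v)) (==-refl (exit v))

  usedIn usedOut : Fin n → List (Fin n)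
  usedIn v = filterᵇ (λ u → F u v) (allFin n)
  usedOut v = filterᵇ (F v) (allFin n)

  -- Adding the exit to the used arcs leaving `v` makes the two lists equally long when `v` is
  -- dirty.
  incoming outgoing : Fin n → List (Fin m)
  incoming v = map (λ u → index u v) (usedIn v)
  outgoing v = exit v ∷ map (index v) (usedOut v)

  usedIn⇒adj : ∀ {u v} → u ∈ usedIn v → adj E u v ≡ true
  usedIn⇒adj {u} {v} u∈ = F⊆E u v (∈-filterᵇ⁻ (λ u → F u v) {xs = allFin n} u∈)

  usedOut⇒adj : ∀ {w v} → w ∈ usedOut v → adj E v w ≡ true
  usedOut⇒adj {w} {v} w∈ = F⊆E v w (∈-filterᵇ⁻ (F v) {xs = allFin n} w∈)

  ∈-incoming : ∀ {i} → used i ≡ true → i ∈ incoming (tgt i)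
  ∈-incoming {i} ui = subst (_∈ incoming (tgt i)) (index-arc i)
    (∈-map⁺ (λ u → index u (tgt i)) (∈-filterᵇ⁺ (λ u → F u (tgt i)) (∈-allFin (src i)) ui))

  incoming⁻ : ∀ {i v} → i ∈ incoming v → tgt i ≡ v × used i ≡ true
  incoming⁻ {v = v} i∈ with u , u∈ , refl ← ∈-map⁻ (λ u → index u v) i∈ =
    tgt-index (usedIn⇒adj u∈) , trans (cong (λ e → F (proj₁ e) (proj₂ e)) (arc-index (usedIn⇒adj u∈)))
      (∈-filterᵇ⁻ (λ u → F u v) {xs = allFin n} u∈)

  ∈-outgoing : ∀ {i} → used i ∨ isExit i ≡ true → i ∈ outgoing (src i)
  ∈-outgoing {i} h with ∨-true {used i} h
  ... | inj₂ e = here (≡.sym (==⇒≡ (exit (src i)) i e))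
  ... | inj₁ ui = there (subst (_∈ map (index (src i)) (usedOut (src i))) (index-arc i)
    (∈-map⁺ (index (src i)) (∈-filterᵇ⁺ (F (src i)) (∈-allFin (tgt i)) ui)))

  usedOut-used : ∀ {w v} → w ∈ usedOut v → used (index v w) ≡ true
  usedOut-used {w} {v} w∈ = trans (cong (λ e → F (proj₁ e) (proj₂ e)) (arc-index (usedOut⇒adj w∈)))
    (∈-filterᵇ⁻ (F v) {xs = allFin n} w∈)

  outgoing⁻ : ∀ {i v} → i ∈ outgoing v → src i ≡ v × used i ∨ isExit i ≡ true
  outgoing⁻ {v = v} (here refl) = src-exit v , ∨-trueʳ {used (exit v)} (isExit-exit v)
  outgoing⁻ {v = v} (there i∈) with w , w∈ , refl ← ∈-map⁻ (index v) i∈ =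
    src-index (usedOut⇒adj w∈) , ∨-trueˡ (usedOut-used w∈)

  unique-incoming : ∀ v → Unique (incoming v)
  unique-incoming v = unique-map (λ u → index u v)
    (λ x∈ y∈ eq → trans (≡.sym (src-index (usedIn⇒adj x∈))) (trans (cong src eq) (src-index (usedIn⇒adj y∈))))
    (Unique.filter⁺ (T? ∘ λ u → F u v) (Unique.allFin⁺ n))

  unique-outgoing : ∀ v → dirty v ≡ true → Unique (outgoing v)
  unique-outgoing v dv = All.tabulate new ∷ unique-map (index v)
    (λ x∈ y∈ eq → trans (≡.sym (tgt-index (usedOut⇒adj x∈))) (trans (cong tgt eq) (tgt-index (usedOut⇒adj y∈))))
    (Unique.filter⁺ (T? ∘ F v) (Unique.allFin⁺ n))
    where
    new : ∀ {i} → i ∈ map (index v) (usedOut v) → exit v ≢ i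
    new i∈ eq with w , w∈ , refl ← ∈-map⁻ (index v) i∈ =
      true≢false (usedOut-used w∈) (subst (λ j → used j ≡ false) eq (exit-unused v dv))

  length-incoming≡length-outgoing : ∀ v → dirty v ≡ true → length (incoming v) ≡ length (outgoing v)
  length-incoming≡length-outgoing v dv = begin
    length (incoming v)  ≡⟨ List.length-map (λ u → index u v) (usedIn v) ⟩
    length (usedIn v)    ≡⟨ length-filterᵇ-allFin (λ u → F u v) ⟩
    inflow F v           ≡⟨ served v dv ⟩
    suc (outflow F v)    ≡⟨ cong suc (length-filterᵇ-allFin (F v)) ⟨
    suc (length (usedOut v)) ≡⟨ cong suc (List.length-map (index v) (usedOut v)) ⟨
    length (outgoing v)  ∎
    where open ≡-Reasoning

  -- `hasNext i` says that `i` is the first arc of a matched pair at its head, and `hasPrev i` that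
  -- it is the second arc of a pair at its tail. Nothing is matched at clean vertices.
  hasNext hasPrev : Fin m → Bool
  hasNext i = dirty (tgt i) ∧ used i
  hasPrev i = dirty (src i) ∧ (used i ∨ isExit i)

  abstract
    next prev : Fin m → Fin m
    next i = assoc (incoming (tgt i)) (outgoing (tgt i)) i
    prev i = assoc (outgoing (src i)) (incoming (src i)) i

    next-spec : ∀ i → hasNext i ≡ true →
      hasPrev (next i) ≡ true × src (next i) ≡ tgt i × prev (next i) ≡ i
    next-spec i h with dv , ui ← ∧-true {dirty (tgt i)} h
      with j∈ , inverse ← assoc-matching (unique-incoming (tgt i)) (unique-outgoing (tgt i) dv)
                            (length-incoming≡length-outgoing (tgt i) dv) (∈-incoming ui)
      with src≡ , h′ ← outgoing⁻ j∈
      = ∧-true⁺ (trans (cong dirty src≡) dv) h′ , src≡ ,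
        trans (cong (λ v → assoc (outgoing v) (incoming v) (next i)) src≡) inverse

    prev-spec : ∀ i → hasPrev i ≡ true →
      hasNext (prev i) ≡ true × tgt (prev i) ≡ src i × next (prev i) ≡ i
    prev-spec i h with dv , h′ ← ∧-true {dirty (src i)} h
      with j∈ , inverse ← assoc-matching (unique-outgoing (src i) dv) (unique-incoming (src i))
                            (≡.sym (length-incoming≡length-outgoing (src i) dv)) (∈-outgoing h′)
      with tgt≡ , ui ← incoming⁻ j∈
      = ∧-true⁺ (trans (cong dirty tgt≡) dv) ui , tgt≡ ,
        trans (cong (λ v → assoc (incoming v) (outgoing v) (prev i)) tgt≡) inverse

  -- `Free` is later taken to mean lying outside N(S), where the completion accepts arbitrary steps
  -- of the cycle.
  Step : V → V → Set
  Step x y = adjGV x y ≡ true ⊎ (Free x × Free y)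

  adj-comm : ∀ x y → adjGV x y ≡ true → adjGV y x ≡ true
  adj-comm x y = trans (∨-comm (gen y x) (gen x y))

  pEdge⇒gen : ∀ i k k′ → pEdge k k′ ≡ true → gen (a i k) (a i k′) ≡ true
  pEdge⇒gen i k k′ e = ∨-trueˡ (∧-true⁺ (==-refl i) e)

  pAdj⇒step : ∀ i k k′ → pAdj k k′ ≡ true → Step (a i k) (a i k′)
  pAdj⇒step i k k′ h with ∨-true {pEdge k k′} h
  ... | inj₁ e = inj₁ (∨-trueˡ (pEdge⇒gen i k k′ e))
  ... | inj₂ e = inj₁ (∨-trueʳ {gen (a i k) (a i k′)} (pEdge⇒gen i k′ k e))

  link⇒adj : ∀ {i j} k k′ → tgt i ≡ src j → link k k′ ≡ true → adjGV (a i k) (a j k′) ≡ true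
  link⇒adj {i} {j} k k′ e l = ∨-trueˡ (∨-trueʳ {i == j ∧ pEdge k k′}
    (∨-trueʳ {k is 31 ∧ k′ is 1 ∧ nextArc i j}
      (∧-true⁺ (trans (cong (tgt i ==_) (≡.sym e)) (==-refl (tgt i))) l)))

  -- Degrees are positive, so every vertex has arcs in both directions and the guards in `gen`
  -- always hold.
  hasIn-true : ∀ v → hasIn v ≡ true
  hasIn-true v with w , vw ← neighbour v = any-true⁺ (λ i → tgt i == v) (∈-allFin (index w v))
    (trans (cong (_== v) (tgt-index (trans (sym E w v) vw))) (==-refl v))

  hasOut-true : ∀ v → hasOut v ≡ true
  hasOut-true v with w , vw ← neighbour v = any-true⁺ (λ i → src i == v) (∈-allFin (index v w))
    (trans (cong (_== v) (src-index vw)) (==-refl v))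

  inPort⇒adj : ∀ i k l → inPort k l ≡ true → adjGV (a i k) (b (src i) l) ≡ true
  inPort⇒adj i k l p = ∨-trueˡ (∨-trueˡ (∧-true⁺ (==-refl (src i)) (∧-true⁺ (hasIn-true (src i)) p)))

  outPort⇒adj : ∀ {i v} k l → tgt i ≡ v → outPort k l ≡ true → adjGV (a i k) (b v l) ≡ true
  outPort⇒adj {i} k l refl p = ∨-trueˡ (∨-trueʳ {src i == tgt i ∧ (hasIn (tgt i) ∧ inPort k l)}
    (∧-true⁺ (==-refl (tgt i)) (∧-true⁺ (hasOut-true (tgt i)) p)))

  bEdge⇒step : ∀ v l l′ → bEdge l l′ ≡ true → Step (b v l) (b v l′)
  bEdge⇒step v l l′ e = inj₁ (∨-trueˡ (∧-true⁺ (==-refl v) (∧-true⁺ (hasIn-true v) (∧-true⁺ (hasOut-true v) e))))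

  segment : ∀ i k ks → linked k ks ≡ true → Path Step (a i k) (a i (endOf k ks)) (map (a i) (k ∷ ks))
  segment i k []        _ = stop
  segment i k (k′ ∷ ks) h with e , h′ ← ∧-true {pAdj k k′} h = pAdj⇒step i k k′ e ∷ segment i k′ ks h′

  -- The exchange: `middle` is the own piece 6-11 or the piece 21-26 of the previous arc, and
  -- `after` is the own piece 21-26 or the piece 6-11 of the next arc. The detours are the two
  -- halves of `b^v`, placed on either side of `middle`.
  middle detour₁ detour₂ after : Fin m → Bool → List V
  middle i true  = map (a (prev i)) segF′
  middle i false = map (a i) segC
  detour₁ i true  = map (b (src i)) ports₁
  detour₁ i false = []
  detour₂ i true  = map (b (src i)) ports₂
  detour₂ i false = []
  after i true  = map (a (next i)) segC′
  after i false = map (a i) segF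

  back : Fin m → (u s : Bool) → List V
  back i u s = map (a i) (segD u) ++ after i s ++ map (a i) (segK u)

  -- The flags (used, exit, has a previous arc, has a next arc) are parameters so that paths and
  -- lengths can be treated by cases before the actual values are inserted.
  blockOf : Fin m → (u e p s : Bool) → List V
  blockOf i u e p s = map (a i) (segA u) ++ detour₁ i e ++ middle i p ++ detour₂ i e ++ back i u s

  block : Fin m → List V
  block i = blockOf i (used i) (isExit i) (hasPrev i) (hasNext i)

  pathA : ∀ i u → Path Step (a i (lab 1)) (a i (endA u)) (map (a i) (segA u))
  pathA i false = segment i _ _ refl
  pathA i true  = segment i _ _ refl

  pathD : ∀ i u → Path Step (a i (startD u)) (a i (endD u)) (map (a i) (segD u))
  pathD i false = segment i _ _ refl
  pathD i true  = segment i _ _ refl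

  pathK : ∀ i u → Path Step (a i (startK u)) (a i (lab 31)) (map (a i) (segK u))
  pathK i false = segment i _ _ refl
  pathK i true  = segment i _ _ refl

  pathC : ∀ i → Path Step (a i (lab 6)) (a i (lab 11)) (map (a i) segC)
  pathC i = segment i _ _ refl

  pathC′ : ∀ i → Path Step (a i (lab 8)) (a i (lab 9)) (map (a i) segC′)
  pathC′ i = segment i _ _ refl

  pathF : ∀ i → Path Step (a i (lab 21)) (a i (lab 26)) (map (a i) segF)
  pathF i = segment i _ _ refl

  pathF′ : ∀ i → Path Step (a i (lab 23)) (a i (lab 24)) (map (a i) segF′)
  pathF′ i = segment i _ _ refl

  pathPorts₁ : ∀ v → Path Step (b v 0F) (b v 2F) (map (b v) ports₁)
  pathPorts₁ v = bEdge⇒step v _ _ refl ∷ (bEdge⇒step v _ _ refl ∷ stop)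

  pathPorts₂ : ∀ v → Path Step (b v 3F) (b v 5F) (map (b v) ports₂)
  pathPorts₂ v = bEdge⇒step v _ _ refl ∷ (bEdge⇒step v _ _ refl ∷ stop)

  back-path : ∀ i u c → used i ≡ u → dirty (tgt i) ≡ c →
    Path Step (a i (startD u)) (a i (lab 31)) (back i u (c ∧ u))
  -- With a clean head the arc keeps its own piece 21-26, whose ends need not fit the rerouted
  -- segments of a used arc; steps between free vertices bridge the gaps.
  back-path i u false ui ct =
    append (pathD i u) (inj₂ (free _ , free _)) (append (pathF i) (inj₂ (free _ , free _)) (pathK i u))
    where
    free : ∀ k → Free (a i k)
    free k = clean⇒Free (a i k) (there (here refl)) ct
  back-path i false true ui dt =
    append (pathD i false) (pAdj⇒step i (lab 20) (lab 21) refl) (append (pathF i) (pAdj⇒step i (lab 26) (lab 27) refl) (pathK i false))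
  -- The piece 6-11 of the next arc is entered along the link edge from 18 to 8 and left along the
  -- one between 9 and 29.
  back-path i true true ui dt with _ , src≡ , _ ← next-spec i (∧-true⁺ dt ui) =
    append (pathD i true) (inj₁ (link⇒adj (lab 18) (lab 8) (≡.sym src≡) refl))
      (append (pathC′ (next i))
        (inj₁ (adj-comm (a i (lab 29)) (a (next i) (lab 9)) (link⇒adj (lab 29) (lab 9) (≡.sym src≡) refl)))
        (pathK i true))

  block-path : ∀ i u e c c′ → used i ≡ u → isExit i ≡ e → dirty (src i) ≡ c → dirty (tgt i) ≡ c′ →
    Path Step (a i (lab 1)) (a i (lab 31)) (blockOf i u e (c ∧ (u ∨ e)) (c′ ∧ u))
  -- At a clean tail `b^v` is still visited, by free steps, in the block of the exit.
  block-path i u true false c′ ui ei cs dt =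
    append (pathA i u) (inj₂ (free _ , freeb _)) (append (pathPorts₁ (src i)) (inj₂ (freeb _ , free _))
      (append (pathC i) (inj₂ (free _ , freeb _)) (append (pathPorts₂ (src i)) (inj₂ (freeb _ , free _))
        (back-path i u c′ ui dt))))
    where
    free : ∀ k → Free (a i k)
    free k = clean⇒Free (a i k) (here refl) cs
    freeb : ∀ l → Free (b (src i) l)
    freeb l = clean⇒Free (b (src i) l) (here refl) cs
  block-path i u false false c′ ui ei cs dt =
    append (pathA i u) (inj₂ (free _ , free _))
      (append (pathC i) (inj₂ (free _ , free _)) (back-path i u c′ ui dt))
    where
    free : ∀ k → Free (a i k)
    free k = clean⇒Free (a i k) (here refl) cs
  block-path i true true true c′ ui ei ds dt = ⊥-elim (true≢false ui
    (subst (λ j → used j ≡ false) (==⇒≡ (exit (src i)) i ei) (exit-unused (src i) ds)))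
  block-path i true false true c′ ui ei ds dt
    with _ , tgt≡ , _ ← prev-spec i (∧-true⁺ ds (∨-trueˡ ui)) =
    append (pathA i true)
      (inj₁ (adj-comm (a (prev i) (lab 23)) (a i (lab 3)) (link⇒adj (lab 23) (lab 3) tgt≡ refl)))
      (append (pathF′ (prev i)) (inj₁ (link⇒adj (lab 24) (lab 14) tgt≡ refl))
        (back-path i true c′ ui dt))
  block-path i false true true c′ ui ei ds dt
    with _ , tgt≡ , _ ← prev-spec i (∧-true⁺ ds (∨-trueʳ {used i} ei)) =
    append (pathA i false) (inj₁ (inPort⇒adj i (lab 5) 0F refl))
      (append (pathPorts₁ (src i)) (inj₁ (adj-comm (a (prev i) (lab 23)) (b (src i) 2F) (outPort⇒adj (lab 23) 2F tgt≡ refl)))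
      (append (pathF′ (prev i)) (inj₁ (outPort⇒adj (lab 24) 3F tgt≡ refl))
      (append (pathPorts₂ (src i)) (inj₁ (adj-comm (a i (lab 12)) (b (src i) 5F) (inPort⇒adj i (lab 12) 5F refl)))
        (back-path i false c′ ui dt))))
  block-path i false false true c′ ui ei ds dt =
    append (pathA i false) (pAdj⇒step i (lab 5) (lab 6) refl)
      (append (pathC i) (pAdj⇒step i (lab 11) (lab 12) refl) (back-path i false c′ ui dt))

  -- Exchanged pieces all have 6 vertices and rerouting permutes a segment, so only the detours
  -- change the length.
  length-blockOf : ∀ i u e p s → length (blockOf i u e p s) ≡ 31 + 6 * ⟦ e ⟧
  length-blockOf i true  true  true  true  = refl
  length-blockOf i true  true  true  false = refl
  length-blockOf i true  true  false true  = refl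
  length-blockOf i true  true  false false = refl
  length-blockOf i true  false true  true  = refl
  length-blockOf i true  false true  false = refl
  length-blockOf i true  false false true  = refl
  length-blockOf i true  false false false = refl
  length-blockOf i false true  true  true  = refl
  length-blockOf i false true  true  false = refl
  length-blockOf i false true  false true  = refl
  length-blockOf i false true  false false = refl
  length-blockOf i false false true  true  = refl
  length-blockOf i false false true  false = refl
  length-blockOf i false false false true  = refl
  length-blockOf i false false false false = refl

  -- Since `src` is a left inverse of `exit`, the exits of the `n` vertices are distinct; the sum
  -- counts pairs `(v, i)` with `exit v` equal to `i` in two ways.
  count-isExit : count isExit ≡ n
  count-isExit = begin
    ∑ (λ i → ⟦ exit (src i) == i ⟧)          ≡⟨ sum-cong-≗ {m} pointwise ⟨
    ∑ (λ i → ∑ (λ v → ⟦ exit v == i ⟧))      ≡⟨ ∑-comm {m} {n} (λ i v → ⟦ exit v == i ⟧) ⟩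
    ∑ (λ v → ∑ (λ i → ⟦ exit v == i ⟧))      ≡⟨ sum-cong-≗ {n} (λ v → trans (sum-cong-≗ {m} λ i → cong ⟦_⟧ (==-comm (exit v) i)) (count-≡ (exit v))) ⟩
    ∑ {n} (λ v → 1)                          ≡⟨ trans (∑-const n 1) (*-identityʳ n) ⟩
    n                                        ∎
    where
    open ≡-Reasoning
    exit≡⇒src≡ : ∀ {v i} → exit v ≡ i → v ≡ src i
    exit≡⇒src≡ {v} e = trans (≡.sym (src-exit v)) (cong src e)
    pointwise : ∀ i → ∑ (λ v → ⟦ exit v == i ⟧) ≡ ⟦ exit (src i) == i ⟧
    pointwise i with exit (src i) ≟ i
    ... | yes e = trans (sum-cong-≗ {n} same) (count-≡ (src i))
      where
      same : ∀ v → ⟦ exit v == i ⟧ ≡ ⟦ v == src i ⟧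
      same v with v ≟ src i
      ... | yes refl = cong ⟦_⟧ (trans (cong (_== i) e) (==-refl i))
      ... | no v≢ = cong ⟦_⟧ (≢⇒==-false (v≢ ∘ exit≡⇒src≡))
    ... | no ¬e = ∑-zero {n} λ v → cong ⟦_⟧ (≢⇒==-false λ e → ¬e (trans (cong exit (≡.sym (exit≡⇒src≡ e))) e))

  tour : List V
  tour = concat (List.tabulate block)

  length-tour : length tour ≡ N
  length-tour = begin
    length tour                               ≡⟨ length-concat-tabulate block ⟩
    ∑ (length ∘ block)                        ≡⟨ sum-cong-≗ {m} (λ i → length-blockOf i (used i) (isExit i) (hasPrev i) (hasNext i)) ⟩
    ∑ (λ i → 31 + 6 * ⟦ isExit i ⟧)           ≡⟨ ∑-distrib-+ {m} (const 31) (λ i → 6 * ⟦ isExit i ⟧) ⟩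
    ∑ {m} (const 31) + ∑ (λ i → 6 * ⟦ isExit i ⟧)
      ≡⟨ cong₂ _+_ (∑-const m 31) (∑-*ˡ 6 (⟦_⟧ ∘ isExit)) ⟩
    m * 31 + 6 * count isExit                 ≡⟨ cong (λ c → m * 31 + 6 * c) count-isExit ⟩
    m * 31 + 6 * n                            ≡⟨ cong (m * 31 +_) (*-comm 6 n) ⟩
    N                                         ∎
    where open ≡-Reasoning

  in-block : ∀ i {z} → z ∈ block i → z ∈ tour
  in-block i z∈ = ∈-concat⁺′ z∈ (∈-tabulate⁺ i)

  module _ (i : Fin m) where

    private
      L₁ L₂ L₃ L₄ L₅ L₆ : List V
      L₁ = map (a i) (segA (used i))
      L₂ = detour₁ i (isExit i)
      L₃ = middle i (hasPrev i)
      L₄ = detour₂ i (isExit i)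
      L₅ = map (a i) (segD (used i))
      L₆ = after i (hasNext i)

    in-A : ∀ {z} → z ∈ map (a i) (segA (used i)) → z ∈ tour
    in-A z∈ = in-block i (∈-++⁺ˡ {xs = L₁} z∈)

    in-detour₁ : ∀ {z} → z ∈ detour₁ i (isExit i) → z ∈ tour
    in-detour₁ z∈ = in-block i (∈-++⁺ʳ L₁ (∈-++⁺ˡ {xs = L₂} z∈))

    in-middle : ∀ {z} → z ∈ middle i (hasPrev i) → z ∈ tour
    in-middle z∈ = in-block i (∈-++⁺ʳ L₁ (∈-++⁺ʳ L₂ (∈-++⁺ˡ {xs = L₃} z∈)))

    in-detour₂ : ∀ {z} → z ∈ detour₂ i (isExit i) → z ∈ tour
    in-detour₂ z∈ = in-block i (∈-++⁺ʳ L₁ (∈-++⁺ʳ L₂ (∈-++⁺ʳ L₃ (∈-++⁺ˡ {xs = L₄} z∈))))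

    in-back : ∀ {z} → z ∈ back i (used i) (hasNext i) → z ∈ tour
    in-back z∈ = in-block i (∈-++⁺ʳ L₁ (∈-++⁺ʳ L₂ (∈-++⁺ʳ L₃ (∈-++⁺ʳ L₄ z∈))))

    in-D : ∀ {z} → z ∈ map (a i) (segD (used i)) → z ∈ tour
    in-D z∈ = in-back (∈-++⁺ˡ {xs = L₅} z∈)

    in-after : ∀ {z} → z ∈ after i (hasNext i) → z ∈ tour
    in-after z∈ = in-back (∈-++⁺ʳ L₅ (∈-++⁺ˡ {xs = L₆} z∈))

    in-K : ∀ {z} → z ∈ map (a i) (segK (used i)) → z ∈ tour
    in-K z∈ = in-back (∈-++⁺ʳ L₅ (∈-++⁺ʳ L₆ z∈))

  -- A piece given away is found in the block of the matched arc, because `next` and `prev` are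
  -- mutually inverse on matched arcs; `b^v` is found in the block of `exit v`. Together with
  -- `length-tour` this means that every vertex is visited exactly once.
  tour-covers : ∀ z → z ∈ tour
  tour-covers (a i k) with located (used i) k
  ... | inj₁ (inj₁ k∈) = in-A i (∈-map⁺ (a i) k∈)
  ... | inj₁ (inj₂ (inj₁ k∈)) = in-D i (∈-map⁺ (a i) k∈)
  ... | inj₁ (inj₂ (inj₂ k∈)) = in-K i (∈-map⁺ (a i) k∈)
  ... | inj₂ (inj₁ (k∈ , k∈′)) with true? (hasPrev i)
  ...   | inj₂ ¬p = in-middle i (subst (λ p → a i k ∈ middle i p) (≡.sym ¬p) (∈-map⁺ (a i) k∈))
  ...   | inj₁ p with n′ , _ , next≡ ← prev-spec i p = in-after (prev i)
    (subst (λ s → a i k ∈ after (prev i) s) (≡.sym n′)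
      (subst (λ j → a j k ∈ map (a (next (prev i))) segC′) next≡ (∈-map⁺ (a (next (prev i))) k∈′)))
  tour-covers (a i k) | inj₂ (inj₂ (k∈ , k∈′)) with true? (hasNext i)
  ...   | inj₂ ¬s = in-after i (subst (λ s → a i k ∈ after i s) (≡.sym ¬s) (∈-map⁺ (a i) k∈))
  ...   | inj₁ s with p′ , _ , prev≡ ← next-spec i s = in-middle (next i)
    (subst (λ p → a i k ∈ middle (next i) p) (≡.sym p′)
      (subst (λ j → a j k ∈ map (a (prev (next i))) segF′) prev≡ (∈-map⁺ (a (prev (next i))) k∈′)))
  tour-covers (b v l) with port-located l
  ... | inj₁ l∈ = in-detour₁ (exit v) (subst (λ e → b v l ∈ detour₁ (exit v) e) (≡.sym (isExit-exit v))
    (subst (λ w → b w l ∈ map (b (src (exit v))) ports₁) (src-exit v) (∈-map⁺ (b (src (exit v))) l∈)))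
  ... | inj₂ l∈ = in-detour₂ (exit v) (subst (λ e → b v l ∈ detour₂ (exit v) e) (≡.sym (isExit-exit v))
    (subst (λ w → b w l ∈ map (b (src (exit v))) ports₂) (src-exit v) (∈-map⁺ (b (src (exit v))) l∈)))

  wrap-step : ∀ i j → CyclicNext i j → Step (a i (lab 31)) (a j (lab 1))
  wrap-step i j h = inj₁ (∨-trueˡ (∨-trueʳ {i == j ∧ pEdge (lab 31) (lab 1)} (∨-trueˡ (cyclicNext⁺ i j h))))

  hamiltonian-cycle : ∃ λ (σ : Fin N → V) → (∀ i j → enc (σ i) ≡ enc (σ j) → i ≡ j) ×
    (∀ i j → CyclicNext i j → Step (σ i) (σ j))
  hamiltonian-cycle with _ , _ , path , closing ← closed-chain someArc
      (λ i → a i (lab 1)) (λ i → a i (lab 31)) block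
      (λ i → block-path i (used i) (isExit i) (dirty (src i)) (dirty (tgt i)) refl refl refl refl) wrap-step =
    closed-path⇒cycle enc path closing length-tour
      (λ x → decode x , tour-covers (decode x) , enc-decode x)

-- Local completion and the choice of δ.

module _ {n d : ℕ} (E : Graph n) (1≤n : 1 ≤ n) (2≤d : 2 ≤ d) (simple : IsSimple E)
  (regular : Regular d E) (expansion : ExpansionAtLeast1 E)
  (m : ℕ) (arc : Fin m → Fin n × Fin n) (order : IsArcOrder E m arc) where

  open Construction E m arc
  open Gadgets E 1≤n 2≤d simple regular m arc order

  local-completion : (S : Subset N) → 2 * count (Dirty.dirty S) ≤ n →
    Σ (Graph N) λ H → InC (d + 3) H × Hamiltonian H ×
      Σ (Subset N) λ T → Σ (Fin N → Fin N) λ φ → LocalIso GE S H T φ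
  local-completion S few
    with F , F⊆E , served ← Flow.unit-demand-flow E (Dirty.dirty S) expansion few
    with σ , σ-injective , σ-steps ← Tour.hamiltonian-cycle E 1≤n 2≤d simple regular m arc order
           (Dirty.dirty S) F F⊆E served (λ z → lookup (closedNbhd GE S) (enc z) ≡ false)
           (λ z v∈ clean → ¬-not λ near → true≢false (Dirty.near⇒dirty S z near v∈) clean)
    = H , H∈C , H-hamiltonian , S , id , H-local-iso
    where
    σ-edges : ∀ i j → CyclicNext i j →
      lookup (closedNbhd GE S) (enc (σ i)) ≡ true ⊎ lookup (closedNbhd GE S) (enc (σ j)) ≡ true →
      adj GE (enc (σ i)) (enc (σ j)) ≡ true
    σ-edges i j h near with σ-steps i j h | near
    ... | inj₁ e | _ = trans (cong₂ adjGV (decode-enc (σ i)) (decode-enc (σ j))) e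
    ... | inj₂ (f , _) | inj₁ ni = ⊥-elim (true≢false ni f)
    ... | inj₂ (_ , f) | inj₂ nj = ⊥-elim (true≢false nj f)
    3≤N : 3 ≤ N
    3≤N = ≤-trans (≤-trans (m≤m+n 3 3) (*-monoˡ-≤ 6 1≤n)) (m≤n+m (n * 6) (m * 31))
    open CycleCompletion GE S (d + 3) (≤-trans 2≤d (m≤m+n d 3)) 3≤N GE∈C (enc ∘ σ) σ-injective σ-edges

theorem5p1 : ∀ (d : ℕ) → 2 ≤ d →
    Σ ℕ λ p → Σ ℕ λ q → 0 < p × p ≤ q ×
    (∀ (n : ℕ) (E : Graph n) → 1 ≤ n → IsSimple E → Regular d E →
    ExpansionAtLeast1 E →
    ∀ (m : ℕ) (arc : Fin m → Fin n × Fin n) → IsArcOrder E m arc →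
    LocallyHamiltonian (d + 3) p q G[ E , m , arc ])
-- The graph has at most `c * n` vertices, as `m ≤ n * d`. The factor `4 * (d + 4)` is twice the
-- bound on dirty vertices per vertex of `S`, so at most half of the vertices of `E` are dirty.
theorem5p1 d 2≤d = 1 , c * (4 * (d + 4)) , s≤s z≤n ,
  *-mono-≤ {1} {c} {1} (s≤s z≤n) (*-mono-≤ {1} {4} (s≤s z≤n) (≤-trans (s≤s z≤n) (m≤n+m 4 d))) ,
  λ n E 1≤n simple regular expansion m arc order →
    let open Gadgets E 1≤n 2≤d simple regular m arc order in
    GE∈C , λ S small →
      local-completion E 1≤n 2≤d simple regular expansion m arc order S
        (few n m ∣ S ∣ (count (Dirty.dirty S)) m≤n*d (Dirty.count-dirty S) small)
  where
  c : ℕ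
  c = 6 + d * 31
  few : ∀ n m s t → m ≤ n * d → t ≤ s * ((d + 4) * 2) →
    c * (4 * (d + 4)) * s ≤ 1 * (m * 31 + n * 6) → 2 * t ≤ n
  few n m s t m≤ t≤ small = *-cancelˡ-≤ c (begin
    c * (2 * t)                  ≤⟨ *-monoʳ-≤ c (*-monoʳ-≤ 2 t≤) ⟩
    c * (2 * (s * ((d + 4) * 2))) ≡⟨ regroup c s d ⟩
    c * (4 * (d + 4)) * s        ≤⟨ small ⟩
    1 * (m * 31 + n * 6)         ≡⟨ *-identityˡ _ ⟩
    m * 31 + n * 6               ≤⟨ +-monoˡ-≤ (n * 6) (*-monoˡ-≤ 31 m≤) ⟩
    n * d * 31 + n * 6           ≡⟨ regroup′ n d ⟩
    c * n                        ∎)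
    where
    open ≤-Reasoning
    regroup : ∀ c s d → c * (2 * (s * ((d + 4) * 2))) ≡ c * (4 * (d + 4)) * s
    regroup = solve-∀
    regroup′ : ∀ n d → n * d * 31 + n * 6 ≡ (6 + d * 31) * n
    regroup′ = solve-∀
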